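{- If a minimally self-adjusting BST algorithm $\mathcal{A}$ satisfies the access lemma via the SOL potential, then $\mathcal{A}$ is local.
   Context: Keys are $[n]=\{1,\dots,n\}$. For a BST $T$ and node $a$, $T(a)$ is the set of keys in the subtree rooted at $a$. A weight function is $w:[n]\to\mathbb{R}_{>0}$, $w(S)=\sum_{a\in S}w(a)$, $W=w([n])$, and the SOL potential is $\Phi_T=\sum_{a\in[n]}\log_2 w(T(a))$. A minimally self-adjusting BST algorithm: when key $s$ is accessed in the current tree $T$, with search path $P$ (nodes on the root-to-$s$ path, including $s$; called the before-path), it replaces $P$ by a BST $A$ on the node set $P$ with root $s$ (the after-tree), reattaching the subtrees hanging off $P$ in the unique order-consistent way, giving $T'$; the cost is $|P|$. It satisfies the access lemma via the SOL potential if there is a constant $c'$ such that always $|P|\le\Phi_T-\Phi_{T'}+c'(1+\log_2\frac{W}{w(s)})$ (for all $n$, $T$, $w$, $s$ and all $T'$ the algorithm can produce). A decomposition of a transformation $P\to A$ is a sequence of BSTs $P=Q_0,Q_1,\dots,Q_k=A$ such that for each $i$, $Q_{i+1}$ is obtained from $Q_i$ by rearranging a path $P_i$ contained in $Q_i$ (a set of nodes forming a downward path in $Q_i$) into a BST $T_i$ on the same nodes and reattaching all the attached subtrees in the unique way given by the key order. It is local with window-size $w$ if: (start) $s\in P_0$; (progress) $P_{i+1}\setminus P_i\neq\emptyset$ for all $i$; (overlap) $P_{i+1}\cap P_i\ne\emptyset$ for all $i$; (no-revisit) $(P_i\setminus P_{i+1})\cap P_j=\emptyset$ for all $j>i+1$;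 (window-size) $|P_i|\le w$ for all $i$. The algorithm is local if there is a constant $w$ such that every before-path $\to$ after-tree transformation it performs has a local decomposition with window-size $w$. -}

module Defs where

open import Data.Nat as ℕ using (ℕ; zero; suc; _<ᵇ_; _≡ᵇ_)
open import Data.Bool using (Bool; true; false; if_then_else_; _∨_)
open import Data.List using (List; []; _∷_; _++_; length; map; upTo)
open import Data.List.Membership.Propositional using (_∈_; _∉_)
open import Data.List.Relation.Unary.Linked using (Linked)
open import Data.List.Relation.Binary.Permutation.Propositional using (_↭_)
open import Data.Product using (Σ; ∃; _×_; _,_; proj₁)
open import Data.Rational as ℚ using (ℚ; Positive; 1ℚ; 0ℚ)
open import Relation.Binary.PropositionalEquality using (_≡_)

data Tree : Set where
  leaf : Tree
  node : Tree → ℕ → Tree → Tree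

inorder : Tree → List ℕ
inorder leaf         = []
inorder (node l k r) = inorder l ++ k ∷ inorder r

root : Tree → List ℕ
root leaf         = []
root (node _ k _) = k ∷ []

keys : ℕ → List ℕ
keys n = map suc (upTo n)

IsBSTOnN : ℕ → Tree → Set
IsBSTOnN n T = inorder T ≡ keys n

IsBSTOn : Tree → List ℕ → Set
IsBSTOn A P = Linked ℕ._<_ (inorder A) × (inorder A ↭ P)

_∈ᵇ_ : ℕ → List ℕ → Bool
x ∈ᵇ []       = false
x ∈ᵇ (y ∷ ys) = (x ≡ᵇ y) ∨ (x ∈ᵇ ys)

searchPath : Tree → ℕ → List ℕ
searchPath leaf s = []
searchPath (node l k r) s =
  if s <ᵇ k then k ∷ searchPath l s
  else if k <ᵇ s then k ∷ searchPath r s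
  else k ∷ []

pathTree : Tree → ℕ → Tree
pathTree leaf s = leaf
pathTree (node l k r) s =
  if s <ᵇ k then node (pathTree l s) k leaf
  else if k <ᵇ s then node leaf k (pathTree r s)
  else node leaf k leaf

-- Rearranging a connected node set p into a BST A, reattaching the
-- hanging subtrees in the unique key-order-consistent way.

hanging : (ℕ → Bool) → Tree → List Tree
hanging p leaf = leaf ∷ []
hanging p (node l k r) =
  if p k then hanging p l ++ hanging p r else node l k r ∷ []

plug : Tree → List Tree → Tree × List Tree
plug leaf []       = leaf , []
plug leaf (t ∷ ts) = t , ts
plug (node l k r) ts with plug l ts
... | l' , ts₁ with plug r ts₁
...   | r' , ts₂ = node l' k r' , ts₂

rearrange : (ℕ → Bool) → Tree → Tree → Tree
rearrange p A leaf = leaf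
rearrange p A (node l k r) =
  if p k then proj₁ (plug A (hanging p (node l k r)))
  else node (rearrange p A l) k (rearrange p A r)

rearrangeL : List ℕ → Tree → Tree → Tree
rearrangeL P = rearrange (λ x → x ∈ᵇ P)

data StartsAt : Tree → List ℕ → Set where
  here  : ∀ {l k r} → StartsAt (node l k r) (k ∷ [])
  goL   : ∀ {l k r P} → StartsAt l P → StartsAt (node l k r) (k ∷ P)
  goR   : ∀ {l k r P} → StartsAt r P → StartsAt (node l k r) (k ∷ P)

data DownPath : Tree → List ℕ → Set where
  top   : ∀ {t P} → StartsAt t P → DownPath t P
  inL   : ∀ {l k r P} → DownPath l P → DownPath (node l k r) P
  inR   : ∀ {l k r P} → DownPath r P → DownPath (node l k r) P

record LocalDecomposition (w s : ℕ) (P A : Tree) : Set where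
  field
    k  : ℕ
    Q  : ℕ → Tree          -- Q 0 , … , Q k
    Ps : ℕ → List ℕ        -- P_0 , … , P_{k-1}
    Ts : ℕ → Tree          -- T_0 , … , T_{k-1}
    first  : Q 0 ≡ P
    last   : Q k ≡ A
    isPath : ∀ i → suc i ℕ.≤ k → DownPath (Q i) (Ps i)
    isBST  : ∀ i → suc i ℕ.≤ k → IsBSTOn (Ts i) (Ps i)
    step   : ∀ i → suc i ℕ.≤ k → Q (suc i) ≡ rearrangeL (Ps i) (Ts i) (Q i)
    start     : 0 ℕ.< k × s ∈ Ps 0
    progress  : ∀ i → suc (suc i) ℕ.≤ k → ∃ λ x → x ∈ Ps (suc i) × x ∉ Ps i
    overlaps  : ∀ i → suc (suc i) ℕ.≤ k → ∃ λ x → x ∈ Ps (suc i) × x ∈ Ps i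
    noRevisit : ∀ i j → suc (suc i) ℕ.< suc j → suc j ℕ.≤ k →
                ∀ x → x ∈ Ps i → x ∉ Ps (suc i) → x ∉ Ps j
    window    : ∀ i → suc i ℕ.≤ k → length (Ps i) ℕ.≤ w

record MinSelfAdjusting : Set₁ where
  field
    -- after n T s A : on access of s in T (a BST on [n]), the algorithm
    -- can replace the search path by the after-tree A
    after : ℕ → Tree → ℕ → Tree → Set
    afterBST  : ∀ {n T s A} → after n T s A → IsBSTOn A (searchPath T s)
    afterRoot : ∀ {n T s A} → after n T s A → root A ≡ s ∷ []

  result : Tree → ℕ → Tree → Tree
  result T s A = rearrangeL (searchPath T s) A T

_^ℚ_ : ℚ → ℕ → ℚ
q ^ℚ zero  = 1ℚ
q ^ℚ suc m = q ℚ.* (q ^ℚ m)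

weight : (ℕ → ℚ) → Tree → ℚ
weight w leaf         = 0ℚ
weight w (node l k r) = weight w l ℚ.+ (w k ℚ.+ weight w r)

-- 2^{Φ_T} = ∏_{a} w(T(a))
expΦ : (ℕ → ℚ) → Tree → ℚ
expΦ w leaf         = 1ℚ
expΦ w (node l k r) = weight w (node l k r) ℚ.* (expΦ w l ℚ.* expΦ w r)

two : ℚ
two = 1ℚ ℚ.+ 1ℚ

IsWeight : ℕ → (ℕ → ℚ) → Set
IsWeight n w = ∀ a → 1 ℕ.≤ a → a ℕ.≤ n → Positive (w a)

-- |P| ≤ Φ_T − Φ_T' + c'(1 + log₂(W/w(s)))   , exponentiated:
-- 2^{|P|} · 2^{Φ_T'} · w(s)^{c'} ≤ 2^{Φ_T} · (2W)^{c'}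
AccessLemmaSOL : MinSelfAdjusting → Set
AccessLemmaSOL 𝒜 = ∃ λ (c : ℕ) →
  ∀ n T s A (w : ℕ → ℚ) → IsBSTOnN n T → 1 ℕ.≤ s → s ℕ.≤ n → IsWeight n w →
  MinSelfAdjusting.after 𝒜 n T s A →
  let P  = searchPath T s
      T' = MinSelfAdjusting.result 𝒜 T s A
      W  = weight w T in
  ((two ^ℚ length P) ℚ.* (expΦ w T' ℚ.* (w s ^ℚ c)))
    ℚ.≤ (expΦ w T ℚ.* ((two ℚ.* W) ^ℚ c))

IsLocal : MinSelfAdjusting → Set
IsLocal 𝒜 = ∃ λ (win : ℕ) →
  ∀ n T s A → IsBSTOnN n T → 1 ℕ.≤ s → s ℕ.≤ n →
  MinSelfAdjusting.after 𝒜 n T s A →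
  LocalDecomposition win s (pathTree T s) A

{-# OPTIONS --safe #-}
module Submission where

open import Defs
open import Data.Bool using (Bool; true; false; not; if_then_else_; T)
open import Data.Bool.Properties using (T-≡; ∨-zeroʳ)
open import Data.Integer as ℤ using (+_)
import Data.Integer.Properties as ℤ
open import Data.List using (List; []; _∷_; [_]; _++_; _∷ʳ_; length; map; concatMap; mapMaybe)
open import Data.List.Membership.Propositional using (_∈_; _∉_; find)
open import Data.List.Membership.Propositional.Properties
  using (∈-++⁺ˡ; ∈-++⁺ʳ; ∈-++⁻; ∈-∃++; ∈-map⁺; ∈-upTo⁺)
open import Data.List.Properties
open import Data.List.Relation.Binary.Permutation.Propositional
  using (_↭_; ↭-refl; ↭-sym; ↭-trans; ↭-reflexive; ↭⇒↭ₛ; prep)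
open import Data.List.Relation.Binary.Permutation.Propositional.Properties
  using (++⁺ˡ; ++⁺; shift; shifts; ∈-resp-↭; ++-comm; ↭-length)
import Data.List.Relation.Binary.Permutation.Setoid.Properties as Permutationₛ
open import Data.List.Relation.Binary.Pointwise using (Pointwise-≡⇒≡)
open import Data.List.Relation.Binary.Sublist.Propositional as Sublist
  using (_⊆_; []; _∷_; ⊆-refl)
open import Data.List.Relation.Binary.Sublist.Propositional.Properties using (All-resp-⊆)
  renaming (++⁺ˡ to ⊆-++⁺ˡ; ++⁺ʳ to ⊆-++⁺ʳ; ++⁺ to ⊆-++⁺)
open import Data.List.Relation.Unary.All as All using (All; []; _∷_)
open import Data.List.Relation.Unary.AllPairs as AllPairs using (AllPairs; []; _∷_)
import Data.List.Relation.Unary.AllPairs.Properties as AllPairs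
open import Data.List.Relation.Unary.Any as Any using (Any; here; there)
open import Data.List.Relation.Unary.Linked as Linked using (Linked)
open import Data.List.Relation.Unary.Linked.Properties using (Linked⇒AllPairs; AllPairs⇒Linked)
open import Data.List.Relation.Unary.Sorted.TotalOrder.Properties using (↗↭↗⇒≋)
open import Data.List.Relation.Unary.Unique.Propositional using (Unique)
import Data.List.Relation.Unary.Unique.Propositional.Properties as Unique
open import Data.Nat as ℕ
  using (ℕ; zero; suc; _<ᵇ_; _≡ᵇ_; _<_; _≤_; z≤n; s≤s; _+_; _∸_; _*_; _^_)
import Data.Nat.Coprimality as Coprime
import Data.Nat.Properties as ℕ
open import Data.List.Membership.DecPropositional ℕ._≟_ using (_∈?_)
open import Data.Nat.Tactic.RingSolver using (solve-∀)
open import Data.Product using (∃; ∃₂; _×_; _,_; proj₁; proj₂)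
open import Data.Rational as ℚ using (ℚ; mkℚ)
import Data.Rational.Properties as ℚ
open import Data.Rational.Unnormalised using (*≡*)
import Data.Rational.Unnormalised.Properties as ℚᵘ
open import Data.Sum using (_⊎_; inj₁; inj₂; [_,_]′; isInj₁; isInj₂)
open import Function using (_∘_; Equivalence)
open import Relation.Binary.PropositionalEquality hiding ([_])
open import Relation.Nullary using (Dec; yes; no; does; contradiction)

-- Give the keys of an initial segment S of the search path a huge weight M and all
-- other keys weight 1. Comparing powers of M, the access lemma says that at most
-- |S| + c nodes of the after-tree A have a key of S in their subtree; hence at most c
-- of them lie outside S. Now go up the path from s. When S is the part not yet
-- processed, keep the other keys as follows: those with a key of S below them in A,
-- together with s, form a path, and the subtrees of A without such keys hang off it,
-- already in final form. Processing the next key p concerns only p and this path of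
-- at most c keys, and whatever then drops out of the path is never touched again.

-- The bound on ancestors must not depend on the number of keys. It does not, because `M` may be
-- chosen after the tree: a single factor `M` outweighs everything in the access lemma that depends
-- on the size of the tree but not on `M`, and only exponents are left to compare. The intermediate
-- trees are easiest to describe backwards in time: start from `A` and remove the keys of the search
-- path from the top. Each of them is the smallest or the largest key that is left, so it is either
-- the outermost key kept on the path or the end of the outer spine of the outermost hanging
-- subtree. In the latter case all keys of that spine have it below them in `A`, so they join the
-- path, and only one side of `s` changes. Read forwards, a removal is one local step. To check such
-- a step it suffices that both trees show the same in-order sequence of window keys and hanging
-- subtrees; no rotation has to be followed.

∈ᵇ⁺ : ∀ {x xs} → x ∈ xs → (x ∈ᵇ xs) ≡ true
∈ᵇ⁺ {x} (here refl) rewrite Equivalence.to T-≡ (ℕ.≡⇒≡ᵇ x x refl) = refl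
∈ᵇ⁺ {x} {y ∷ _} (there x∈xs) rewrite ∈ᵇ⁺ x∈xs = ∨-zeroʳ (x ≡ᵇ y)

∉ᵇ⁺ : ∀ {x} xs → x ∉ xs → (x ∈ᵇ xs) ≡ false
∉ᵇ⁺ []           _    = refl
∉ᵇ⁺ {x} (y ∷ xs) x∉xs with x ≡ᵇ y in eq
... | true  = contradiction (here (ℕ.≡ᵇ⇒≡ x y (Equivalence.from T-≡ eq))) x∉xs
... | false = ∉ᵇ⁺ xs (x∉xs ∘ there)

-- Marked trees and rearrangements as equality of item sequences

-- A tree whose nodes on top (mk) are marked and whose other nodes form the
-- unmarked subtrees (gap): the marked set is closed under ancestors.
data Marked : Set where
  gap : Tree → Marked
  mk  : Marked → ℕ → Marked → Marked

erase : Marked → Tree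
erase (gap t)    = t
erase (mk l k r) = node (erase l) k (erase r)

topTree : Marked → Tree
topTree (gap _)    = leaf
topTree (mk l k r) = node (topTree l) k (topTree r)

Item : Set
Item = Tree ⊎ ℕ

-- The invariant of rearranging the marked part: a gap is a single entry, because a rearrangement
-- moves hanging subtrees as a whole.
items : Marked → List Item
items (gap t)    = [ inj₁ t ]
items (mk l k r) = items l ++ inj₂ k ∷ items r

marks : List Item → List ℕ
marks = mapMaybe isInj₂

gaps : List Item → List Tree
gaps = mapMaybe isInj₁

itemKeys : Item → List ℕ
itemKeys = [ inorder , [_] ]′

inorder-erase : ∀ M → inorder (erase M) ≡ concatMap itemKeys (items M)
inorder-erase (gap t)    = sym (++-identityʳ (inorder t))
inorder-erase (mk l k r)
  rewrite inorder-erase l | inorder-erase r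
  = sym (concatMap-++ itemKeys (items l) (inj₂ k ∷ items r))

inorder-topTree : ∀ M → inorder (topTree M) ≡ marks (items M)
inorder-topTree (gap t)    = refl
inorder-topTree (mk l k r)
  rewrite inorder-topTree l | inorder-topTree r
  = sym (mapMaybe-++ isInj₂ (items l) (inj₂ k ∷ items r))

gaps-mk : ∀ l k r → gaps (items (mk l k r)) ≡ gaps (items l) ++ gaps (items r)
gaps-mk l k r = mapMaybe-++ isInj₁ (items l) (inj₂ k ∷ items r)

-- The surplus `ts` makes the induction go through: what the left subtree does not consume is passed
-- on to the right one.
plug-topTree : ∀ M ts → plug (topTree M) (gaps (items M) ++ ts) ≡ (erase M , ts)
plug-topTree (gap t)    ts = refl
plug-topTree (mk l k r) ts
  rewrite gaps-mk l k r
        | ++-assoc (gaps (items l)) (gaps (items r)) ts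
        | plug-topTree l (gaps (items r) ++ ts)
        | plug-topTree r ts
  = refl

MarkedBy : (ℕ → Bool) → Marked → Set
MarkedBy p (gap t)    = ∀ {x} → x ∈ inorder t → p x ≡ false
MarkedBy p (mk l k r) = MarkedBy p l × p k ≡ true × MarkedBy p r

hanging-erase : ∀ {p} M → MarkedBy p M → hanging p (erase M) ≡ gaps (items M)
hanging-erase (gap leaf) _ = refl
hanging-erase (gap (node l k r)) h
  rewrite h (∈-++⁺ʳ (inorder l) (here refl)) = refl
hanging-erase (mk l k r) (hl , hk , hr)
  rewrite hk | gaps-mk l k r | hanging-erase l hl | hanging-erase r hr = refl

keys↭marks++gaps : ∀ xs →
  concatMap itemKeys xs ↭ marks xs ++ concatMap inorder (gaps xs)
keys↭marks++gaps []            = ↭-refl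
keys↭marks++gaps (inj₁ t ∷ xs) =
  ↭-trans (++⁺ˡ (inorder t) (keys↭marks++gaps xs))
          (shifts (inorder t) (marks xs))
keys↭marks++gaps (inj₂ k ∷ xs) = prep k (keys↭marks++gaps xs)

AllPairs-++-cross : ∀ {a ℓ} {A : Set a} {R : A → A → Set ℓ} xs {ys} → AllPairs R (xs ++ ys) →
                    ∀ {x y} → x ∈ xs → y ∈ ys → R x y
AllPairs-++-cross (_ ∷ xs) (px ∷ _) (here refl) y∈ = All.lookup px (∈-++⁺ʳ xs y∈)
AllPairs-++-cross (_ ∷ xs) (_ ∷ ps) (there x∈)  y∈ = AllPairs-++-cross xs ps x∈ y∈

markedBy : ∀ {p} M →
  (∀ {x} → x ∈ marks (items M) → p x ≡ true) →
  (∀ {x} → x ∈ concatMap inorder (gaps (items M)) → p x ≡ false) →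
  MarkedBy p M
markedBy (gap t) _ f x∈t = f (∈-++⁺ˡ x∈t)
markedBy (mk l k r) h f
  rewrite mapMaybe-++ isInj₂ (items l) (inj₂ k ∷ items r) | gaps-mk l k r
        | concatMap-++ inorder (gaps (items l)) (gaps (items r))
  = markedBy l (h ∘ ∈-++⁺ˡ) (f ∘ ∈-++⁺ˡ)
  , h (∈-++⁺ʳ (marks (items l)) (here refl))
  , markedBy r (h ∘ ∈-++⁺ʳ (marks (items l)) ∘ there)
               (f ∘ ∈-++⁺ʳ (concatMap inorder (gaps (items l))))

Unique-resp-↭ : ∀ {xs ys : List ℕ} → xs ↭ ys → Unique xs → Unique ys
Unique-resp-↭ p = Permutationₛ.Unique-resp-↭ (setoid ℕ) (↭⇒↭ₛ p)

rearrangeL-root : ∀ {P k} A l r → k ∈ P →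
  rearrangeL P A (node l k r) ≡ proj₁ (plug A (hanging (_∈ᵇ P) (node l k r)))
rearrangeL-root _ _ _ k∈P rewrite ∈ᵇ⁺ k∈P = refl

-- Equal item sequences have the same gaps in the same order, so plugging the gaps of the old tree
-- into `topTree M` rebuilds `M`. The old tree has a marked root, so `rearrange` acts right there;
-- distinct keys ensure that cutting at `P` stops exactly at the gaps.
rearrange-items : ∀ {P l k r} M →
  items (mk l k r) ≡ items M → marks (items M) ↭ P →
  Unique (inorder (erase (mk l k r))) →
  rearrangeL P (topTree M) (erase (mk l k r)) ≡ erase M
rearrange-items {P} {l} {k} {r} M eq perm u = begin
  rearrangeL P (topTree M) (erase N)
    ≡⟨ rearrangeL-root (topTree M) (erase l) (erase r) (∈P (subst (k ∈_) (inorder-topTree N)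
                            (∈-++⁺ʳ (inorder (topTree l)) (here refl)))) ⟩
  proj₁ (plug (topTree M) (hanging (_∈ᵇ P) (erase N)))
    ≡⟨ cong (proj₁ ∘ plug (topTree M)) (hanging-erase N by) ⟩
  proj₁ (plug (topTree M) (gaps (items N)))
    ≡⟨ cong (proj₁ ∘ plug (topTree M)) (cong gaps eq) ⟩
  proj₁ (plug (topTree M) (gaps (items M)))
    ≡⟨ cong (proj₁ ∘ plug (topTree M)) (sym (++-identityʳ (gaps (items M)))) ⟩
  proj₁ (plug (topTree M) (gaps (items M) ++ []))
    ≡⟨ cong proj₁ (plug-topTree M []) ⟩
  erase M ∎
  where
  open ≡-Reasoning
  N = mk l k r
  u′ : Unique (marks (items N) ++ concatMap inorder (gaps (items N)))
  u′ = Unique-resp-↭ (keys↭marks++gaps (items N)) (subst Unique (inorder-erase N) u)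
  ∈P : ∀ {x} → x ∈ marks (items N) → x ∈ P
  ∈P = ∈-resp-↭ (↭-trans (↭-reflexive (cong marks eq)) perm)
  P∈ : ∀ {x} → x ∈ P → x ∈ marks (items N)
  P∈ = ∈-resp-↭ (↭-sym (↭-trans (↭-reflexive (cong marks eq)) perm))
  by : MarkedBy (_∈ᵇ P) N
  by = markedBy N (∈ᵇ⁺ ∘ ∈P)
         (λ x∈g → ∉ᵇ⁺ P (λ x∈P → AllPairs-++-cross (marks (items N)) u′ (P∈ x∈P) x∈g refl))

-- Marked parts that form a downward path

markedPreorder : Marked → List ℕ
markedPreorder (gap _)    = []
markedPreorder (mk l k r) = k ∷ markedPreorder l ++ markedPreorder r

marks↭markedPreorder : ∀ M → marks (items M) ↭ markedPreorder M
marks↭markedPreorder (gap _)    = ↭-refl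
marks↭markedPreorder (mk l k r) =
  ↭-trans (↭-reflexive (mapMaybe-++ isInj₂ (items l) (inj₂ k ∷ items r)))
  (↭-trans (shift k (marks (items l)) (marks (items r)))
           (prep k (++⁺ (marks↭markedPreorder l) (marks↭markedPreorder r))))

data Linear : Marked → Set where
  end : ∀ {x k y} → Linear (mk (gap x) k (gap y))
  onL : ∀ {M k y} → Linear M → Linear (mk M k (gap y))
  onR : ∀ {x k M} → Linear M → Linear (mk (gap x) k M)

linear-path : ∀ {M} → Linear M → StartsAt (erase M) (markedPreorder M)
linear-path end     = here
linear-path (onL {M} L) rewrite ++-identityʳ (markedPreorder M) = goL (linear-path L)
linear-path (onR L) = goR (linear-path L)

-- Mirror-symmetric notation, spines and their exposure

-- The flag b is the side of s on which a key lies (true: left of s), and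
-- join b xs ys puts the outer part xs on that side of the inner part ys.
join : ∀ {a} {A : Set a} → Bool → List A → List A → List A
join true  xs ys = xs ++ ys
join false xs ys = ys ++ xs

join-assoc : ∀ {a} {A : Set a} b (xs ys zs : List A) →
             join b (join b xs ys) zs ≡ join b xs (join b ys zs)
join-assoc true  xs ys zs = ++-assoc xs ys zs
join-assoc false xs ys zs = sym (++-assoc zs ys xs)

join-identityʳ : ∀ {a} {A : Set a} b (xs : List A) → join b xs [] ≡ xs
join-identityʳ true  xs = ++-identityʳ xs
join-identityʳ false xs = refl

join-[]-injective : ∀ {a} {A : Set a} b {x y : A} {xs ys} →
                    join b [ x ] xs ≡ join b [ y ] ys → x ≡ y × xs ≡ ys
join-[]-injective true  eq = ∷-injective eq
join-[]-injective false {xs = xs} {ys} eq with ∷ʳ-injective xs ys eq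
... | xs≡ys , x≡y = x≡y , xs≡ys

concatMap-join : ∀ {a c} {A : Set a} {C : Set c} (f : A → List C) b xs ys →
                 concatMap f (join b xs ys) ≡ join b (concatMap f xs) (concatMap f ys)
concatMap-join f true  xs ys = concatMap-++ f xs ys
concatMap-join f false xs ys = concatMap-++ f ys xs

join-↭ : ∀ {a} {A : Set a} b (xs ys : List A) → join b xs ys ↭ xs ++ ys
join-↭ true  xs ys = ↭-refl
join-↭ false xs ys = ++-comm ys xs

sideNode : Bool → Tree → ℕ → Tree → Tree
sideNode true  o k i = node o k i
sideNode false o k i = node i k o

sideMk : Bool → Marked → ℕ → Marked → Marked
sideMk true  o k i = mk o k i
sideMk false o k i = mk i k o

erase-sideMk : ∀ b o k i → erase (sideMk b o k i) ≡ sideNode b (erase o) k (erase i)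
erase-sideMk true  o k i = refl
erase-sideMk false o k i = refl

items-sideMk : ∀ b o k i →
  items (sideMk b o k i) ≡ join b (items o) (join b [ inj₂ k ] (items i))
items-sideMk true  o k i = refl
items-sideMk false o k i = sym (++-assoc (items i) [ inj₂ k ] (items o))

inorder-sideNode : ∀ b k i → inorder (sideNode b leaf k i) ≡ join b [ k ] (inorder i)
inorder-sideNode true  k i = refl
inorder-sideNode false k i = refl

-- Marked keys from the outside inwards, each with the gap on its inner side.
Spine : Set
Spine = List (ℕ × Tree)

spineItems : Bool → Spine → List Item
spineItems b []            = []
spineItems b ((u , g) ∷ L) = join b [ inj₂ u ] (join b [ inj₁ g ] (spineItems b L))

-- The spine as a path that descends inwards. The innermost gap goes to the continuation `K`,
-- because it becomes a child of whatever follows the spine.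
chain : Bool → Marked → Spine → (Marked → Marked) → Marked
chain b M []            K = K M
chain b M ((u , g) ∷ L) K = sideMk b M u (chain b (gap g) L K)

-- Mark the outer spine of the outermost gap; the gap outside it is then empty.
expose : Bool → Tree → Spine → Spine
expose b     leaf         L = L
expose true  (node l a r) L = expose true l ((a , r) ∷ L)
expose false (node l a r) L = expose false r ((a , l) ∷ L)

markSpine : Bool → Tree → Marked
markSpine b     leaf         = gap leaf
markSpine true  (node l a r) = mk (markSpine true l) a (gap r)
markSpine false (node l a r) = mk (gap l) a (markSpine false r)

erase-markSpine : ∀ b t → erase (markSpine b t) ≡ t
erase-markSpine true  leaf         = refl
erase-markSpine false leaf         = refl
erase-markSpine true  (node l a r) = cong (λ l → node l a r) (erase-markSpine true l)
erase-markSpine false (node l a r) = cong (node l a) (erase-markSpine false r)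

-- The outer spine of `t` ends in an empty tree. It accounts for the `leaf` item, which reappears in
-- `peel-items` as the outer child of the path key.
items-expose : ∀ b t L → join b (items (markSpine b t)) (spineItems b L)
                       ≡ join b [ inj₁ leaf ] (spineItems b (expose b t L))
items-expose true  leaf         L = refl
items-expose false leaf         L = refl
items-expose true  (node l a r) L =
  trans (++-assoc (items (markSpine true l)) (inj₂ a ∷ inj₁ r ∷ []) (spineItems true L))
        (items-expose true l ((a , r) ∷ L))
items-expose false (node l a r) L =
  trans (trans (cong (spineItems false L ++_) (sym (++-assoc [ inj₁ l ] [ inj₂ a ] _)))
               (trans (sym (++-assoc (spineItems false L) ([ inj₁ l ] ++ [ inj₂ a ]) _))
                      (cong (_++ items (markSpine false r))
                            (sym (++-assoc (spineItems false L) [ inj₁ l ] [ inj₂ a ])))))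
        (items-expose false r ((a , l) ∷ L))

items-chain : ∀ b M L K Z → (∀ x → items (K x) ≡ join b (items x) Z) →
  items (chain b M L K) ≡ join b (join b (items M) (spineItems b L)) Z
items-chain b M [] K Z h =
  trans (h M) (cong (λ xs → join b xs Z) (sym (join-identityʳ b (items M))))
items-chain b M ((u , g) ∷ L) K Z h = begin
  items (sideMk b M u (chain b (gap g) L K))
    ≡⟨ items-sideMk b M u _ ⟩
  join b (items M) (join b [ inj₂ u ] (items (chain b (gap g) L K)))
    ≡⟨ cong (λ xs → join b (items M) (join b [ inj₂ u ] xs)) (items-chain b (gap g) L K Z h) ⟩
  join b (items M) (join b [ inj₂ u ] (join b (join b [ inj₁ g ] (spineItems b L)) Z))
    ≡⟨ cong (join b (items M)) (sym (join-assoc b [ inj₂ u ] _ Z)) ⟩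
  join b (items M) (join b (spineItems b ((u , g) ∷ L)) Z)
    ≡⟨ sym (join-assoc b (items M) _ Z) ⟩
  join b (join b (items M) (spineItems b ((u , g) ∷ L))) Z ∎
  where open ≡-Reasoning

upd : ∀ {a} {A : Set a} → Bool → A → (Bool → A) → Bool → A
upd true  x f true  = x
upd true  x f false = f false
upd false x f true  = f true
upd false x f false = x

upd-same : ∀ {a} {A : Set a} b (x : A) f → upd b x f b ≡ x
upd-same true  x f = refl
upd-same false x f = refl

upd-other : ∀ {a} {A : Set a} b (x : A) f → upd b x f (not b) ≡ f (not b)
upd-other true  x f = refl
upd-other false x f = refl

-- States, peeling, and one step of the decomposition

-- The tree on the keys not yet peeled off: on each side of s, the outermost gap
-- and the spine.
record State : Set where
  constructor state
  field
    outerGap : Bool → Tree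
    spine    : Bool → Spine
open State

pop : Bool → Spine → State → State
pop b []            σ           = σ
pop b ((_ , h) ∷ L) (state g S) = state (upd b h g) (upd b L S)

-- One step back in time: the remaining keys in the arrangement they have before the outermost key
-- on side `b` is processed. The gap inside that key becomes the outermost one. Along a path,
-- `peel-keys` excludes the empty case of `pop`.
peel : Bool → State → State
peel b σ = pop b (expose b (outerGap σ b) (spine σ b)) σ

-- Path of directions: (true , p) says that the search for s leaves p to the right.
Dirs : Set
Dirs = List (Bool × ℕ)

dirTree : ℕ → Dirs → Tree
dirTree s []             = node leaf s leaf
dirTree s ((b , p) ∷ ps) = sideNode b leaf p (dirTree s ps)

sideItems : (Bool → Marked) → (Bool → Spine) → Bool → List Item
sideItems M L b = join b (items (M b)) (spineItems b (L b))

erase-chain : ∀ b {M M′} L {K K′} → erase M ≡ erase M′ →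
  (∀ x x′ → erase x ≡ erase x′ → erase (K x) ≡ erase (K′ x′)) →
  erase (chain b M L K) ≡ erase (chain b M′ L K′)
erase-chain b     []            eq h = h _ _ eq
erase-chain true  ((u , g) ∷ L) eq h = cong₂ (λ l → node l u) eq (erase-chain true L refl h)
erase-chain false ((u , g) ∷ L) eq h = cong₂ (λ l r → node l u r) (erase-chain false L refl h) eq

itemKeys-leaf : ∀ b xs → concatMap itemKeys (join b [ inj₁ leaf ] xs) ≡ concatMap itemKeys xs
itemKeys-leaf true  xs = refl
itemKeys-leaf false xs = trans (concatMap-++ itemKeys xs [ inj₁ leaf ]) (++-identityʳ _)

module _ (s : ℕ) where

  -- With gaps for `M`, the marked part is a path: left spine, right spine, and `s` at the bottom.
  -- `M` consists of marked trees so that `exposed` is an instance too.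
  assemble : (Bool → Marked) → (Bool → Spine) → Marked
  assemble M L = chain true  (M true)  (L true)  λ x →
                 chain false (M false) (L false) λ y → mk x s y

  current : State → Marked
  current (state g L) = assemble (gap ∘ g) L

  -- The outcome of a step with its window marked. As a tree it is `current σ`; the additional marks
  -- are on the outer spine of the outermost gap, which the step rebuilds as well.
  exposed : Bool → State → Marked
  exposed b (state g L) = assemble (upd b (markSpine b (g b)) (gap ∘ g)) L

  items-assemble : ∀ b M L → items (assemble M L) ≡
    join b (sideItems M L b) (join b [ inj₂ s ] (sideItems M L (not b)))
  items-assemble true M L =
    items-chain true (M true) (L true) _ (inj₂ s ∷ sideItems M L false) λ x →
      trans (items-chain false (M false) (L false) (λ y → mk x s y) (items x ++ [ inj₂ s ])
               (λ y → sym (++-assoc (items x) [ inj₂ s ] (items y))))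
            (++-assoc (items x) [ inj₂ s ] (sideItems M L false))
  items-assemble false M L =
    trans (items-assemble true M L)
          (sym (++-assoc (sideItems M L true) [ inj₂ s ] (sideItems M L false)))

  erase-assemble : ∀ M M′ L → (∀ b → erase (M b) ≡ erase (M′ b)) →
                   erase (assemble M L) ≡ erase (assemble M′ L)
  erase-assemble M M′ L eq =
    erase-chain true (L true) (eq true) λ x x′ ex →
    erase-chain false (L false) (eq false) λ y y′ ey → cong₂ (λ l → node l s) ex ey

  erase-exposed : ∀ b σ → erase (exposed b σ) ≡ erase (current σ)
  erase-exposed true  (state g L) = erase-assemble (upd true (markSpine true (g true)) (gap ∘ g)) (gap ∘ g) L
    λ { true → erase-markSpine true (g true) ; false → refl }
  erase-exposed false (state g L) = erase-assemble (upd false (markSpine false (g false)) (gap ∘ g)) (gap ∘ g) L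
    λ { true → refl ; false → erase-markSpine false (g false) }

  items-exposed : ∀ b σ → items (exposed b σ) ≡
    join b (join b [ inj₁ leaf ] (spineItems b (expose b (outerGap σ b) (spine σ b))))
           (join b [ inj₂ s ] (sideItems (gap ∘ outerGap σ) (spine σ) (not b)))
  items-exposed b (state g L)
    rewrite items-assemble b (upd b (markSpine b (g b)) (gap ∘ g)) L
          | upd-same b (markSpine b (g b)) (gap ∘ g)
          | upd-other b (markSpine b (g b)) (gap ∘ g)
          | items-expose b (g b) (L b)
    = refl

  items-pop : ∀ b {p h L} σ → items (current (pop b ((p , h) ∷ L) σ)) ≡
    join b (join b [ inj₁ h ] (spineItems b L))
           (join b [ inj₂ s ] (sideItems (gap ∘ outerGap σ) (spine σ) (not b)))
  items-pop b {p} {h} {L} (state g S)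
    rewrite items-assemble b (gap ∘ upd b h g) (upd b L S)
          | upd-same b h g | upd-same b L S | upd-other b h g | upd-other b L S
    = refl

  -- By `rearrange-items` this makes the two trees rearrangements of each other: putting `p` on top
  -- of the peeled state and rearranging the window yields `exposed b σ`.
  peel-items : ∀ b {p h L} σ → expose b (outerGap σ b) (spine σ b) ≡ (p , h) ∷ L →
    items (sideMk b (gap leaf) p (current (peel b σ))) ≡ items (exposed b σ)
  peel-items b {p} {h} {L} σ eq
    rewrite items-exposed b σ | eq
          | items-sideMk b (gap leaf) p (current (pop b ((p , h) ∷ L) σ))
          | items-pop b {p} {h} {L} σ
    = sym (trans (join-assoc b [ inj₁ leaf ] _ _)
                 (cong (join b [ inj₁ leaf ]) (join-assoc b [ inj₂ p ] _ _)))

  stateKeys : State → List ℕ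
  stateKeys σ = inorder (erase (current σ))

  -- Both key sequences are compared at their end on side `b`. The path has `p` there and the state
  -- has its outermost exposed key, so the two coincide. If nothing were exposed, the state would
  -- have `s` there, which differs from `p`.
  peel-keys : ∀ b {p ps} σ → s ≢ p → stateKeys σ ≡ inorder (dirTree s ((b , p) ∷ ps)) →
    ∃₂ λ h L → expose b (outerGap σ b) (spine σ b) ≡ (p , h) ∷ L ×
               stateKeys (peel b σ) ≡ inorder (dirTree s ps)
  peel-keys b {p} {ps} σ s≢p eq with expose b (outerGap σ b) (spine σ b) in e
  ... | [] = contradiction (proj₁ (join-[]-injective b {xs = Y} (trans (sym state-keys) eq′))) s≢p
    where
    Y = concatMap itemKeys (sideItems (gap ∘ outerGap σ) (spine σ) (not b))
    state-keys : stateKeys σ ≡ join b [ s ] Y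
    state-keys = begin
      stateKeys σ                                 ≡⟨ cong inorder (sym (erase-exposed b σ)) ⟩
      inorder (erase (exposed b σ))               ≡⟨ inorder-erase (exposed b σ) ⟩
      concatMap itemKeys (items (exposed b σ))    ≡⟨ cong (concatMap itemKeys) (items-exposed b σ) ⟩
      concatMap itemKeys (join b (join b [ inj₁ leaf ] (spineItems b (expose b (outerGap σ b) (spine σ b)))) Z)
        ≡⟨ cong (λ L → concatMap itemKeys (join b (join b [ inj₁ leaf ] (spineItems b L)) Z)) e ⟩
      concatMap itemKeys (join b (join b [ inj₁ leaf ] []) Z)
        ≡⟨ cong (λ xs → concatMap itemKeys (join b xs Z)) (join-identityʳ b [ inj₁ leaf ]) ⟩
      concatMap itemKeys (join b [ inj₁ leaf ] Z) ≡⟨ itemKeys-leaf b Z ⟩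
      concatMap itemKeys Z                        ≡⟨ concatMap-join itemKeys b [ inj₂ s ] _ ⟩
      join b [ s ] Y                              ∎
      where
      open ≡-Reasoning
      Z = join b [ inj₂ s ] (sideItems (gap ∘ outerGap σ) (spine σ) (not b))
    eq′ : stateKeys σ ≡ join b [ p ] (inorder (dirTree s ps))
    eq′ = trans eq (inorder-sideNode b p _)
  ... | (q , h) ∷ L with join-[]-injective b (trans (sym state-keys) eq′)
    where
    σ′ = pop b ((q , h) ∷ L) σ
    state-keys : stateKeys σ ≡ join b [ q ] (stateKeys σ′)
    state-keys = begin
      stateKeys σ                                 ≡⟨ cong inorder (sym (erase-exposed b σ)) ⟩
      inorder (erase (exposed b σ))               ≡⟨ inorder-erase (exposed b σ) ⟩
      concatMap itemKeys (items (exposed b σ))    ≡⟨ cong (concatMap itemKeys) (sym (peel-items b σ e)) ⟩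
      concatMap itemKeys (items (sideMk b (gap leaf) q (current (peel b σ))))
        ≡⟨ sym (inorder-erase (sideMk b (gap leaf) q (current (peel b σ)))) ⟩
      inorder (erase (sideMk b (gap leaf) q (current (peel b σ))))
        ≡⟨ cong inorder (erase-sideMk b (gap leaf) q (current (peel b σ))) ⟩
      inorder (sideNode b leaf q (erase (current (peel b σ))))
        ≡⟨ inorder-sideNode b q _ ⟩
      join b [ q ] (stateKeys (peel b σ))         ≡⟨ cong (λ S → join b [ q ] (stateKeys (pop b S σ))) e ⟩
      join b [ q ] (stateKeys σ′)                 ∎
      where open ≡-Reasoning
    eq′ : stateKeys σ ≡ join b [ p ] (inorder (dirTree s ps))
    eq′ = trans eq (inorder-sideNode b p _)
  ...   | refl , eqs = h , L , refl , eqs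

-- Sublists, sortedness and counting

AllPairs-resp-⊆ : ∀ {a ℓ} {A : Set a} {R : A → A → Set ℓ} {xs ys} →
                  xs ⊆ ys → AllPairs R ys → AllPairs R xs
AllPairs-resp-⊆ []         _        = []
AllPairs-resp-⊆ (_ Sublist.∷ʳ τ) (_ ∷ ps) = AllPairs-resp-⊆ τ ps
AllPairs-resp-⊆ (refl ∷ τ) (p ∷ ps) = All-resp-⊆ τ p ∷ AllPairs-resp-⊆ τ ps

marks-⊆ : ∀ xs → marks xs ⊆ concatMap itemKeys xs
marks-⊆ []            = []
marks-⊆ (inj₁ t ∷ xs) = ⊆-++⁺ˡ (inorder t) (marks-⊆ xs)
marks-⊆ (inj₂ k ∷ xs) = refl ∷ marks-⊆ xs

Sorted : List ℕ → Set
Sorted = AllPairs _<_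

sorted-unique : ∀ {xs} → Sorted xs → Unique xs
sorted-unique = AllPairs.map ℕ.<⇒≢

join-⊆ʳ : ∀ {a} {A : Set a} b (xs ys : List A) → ys ⊆ join b xs ys
join-⊆ʳ true  xs ys = ⊆-++⁺ˡ xs ⊆-refl
join-⊆ʳ false xs ys = ⊆-++⁺ʳ xs ⊆-refl

unique-⊆-length : ∀ {a} {A : Set a} {xs ys : List A} → Unique xs →
                  (∀ {x} → x ∈ xs → x ∈ ys) → length xs ≤ length ys
unique-⊆-length {xs = []}     _        _   = z≤n
unique-⊆-length {xs = x ∷ xs} {ys} (px ∷ u) sub with ∈-∃++ (sub (here refl))
... | us , vs , refl = begin
  suc (length xs)         ≤⟨ s≤s (unique-⊆-length u sub′) ⟩
  suc (length (us ++ vs)) ≡⟨ sym (↭-length (shift x us vs)) ⟩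
  length ys               ∎
  where
  open ℕ.≤-Reasoning
  sub′ : ∀ {y} → y ∈ xs → y ∈ us ++ vs
  sub′ y∈xs with ∈-resp-↭ (shift x us vs) (sub (there y∈xs))
  ... | here refl = contradiction refl (All.lookup px y∈xs)
  ... | there y∈  = y∈

-- Subtrees and ancestors of a set of keys

data Sub : Tree → Tree → Set where
  here : ∀ {t} → Sub t t
  inL  : ∀ {t l k r} → Sub t l → Sub t (node l k r)
  inR  : ∀ {t l k r} → Sub t r → Sub t (node l k r)

sub-left : ∀ {l k r A} → Sub (node l k r) A → Sub l A
sub-left here    = inL here
sub-left (inL S) = inL (sub-left S)
sub-left (inR S) = inR (sub-left S)

sub-right : ∀ {l k r A} → Sub (node l k r) A → Sub r A
sub-right here    = inR here
sub-right (inL S) = inL (sub-right S)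
sub-right (inR S) = inR (sub-right S)

Meets : List ℕ → Tree → Set
Meets V t = Any (_∈ V) (inorder t)

meets? : ∀ V t → Dec (Meets V t)
meets? V t = Any.any? (_∈? V) (inorder t)

ancestorHere : List ℕ → Tree → ℕ → List ℕ
ancestorHere V t k = if does (meets? V t) then [ k ] else []

-- Ancestry is reflexive: a key of `V` in the tree is itself listed. Hence a bound `length V + c`
-- leaves room for `c` ancestors outside `V`.
ancestors : List ℕ → Tree → List ℕ
ancestors V leaf         = []
ancestors V (node l k r) = ancestors V l ++ ancestorHere V (node l k r) k ++ ancestors V r

∈-ancestors : ∀ {V A l k r} → Sub (node l k r) A → Meets V (node l k r) → k ∈ ancestors V A
∈-ancestors {V} {l = l} {k} {r} here m with meets? V (node l k r)
... | yes _ = ∈-++⁺ʳ (ancestors V l) (here refl)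
... | no ¬m = contradiction m ¬m
∈-ancestors (inL S) m = ∈-++⁺ˡ (∈-ancestors S m)
∈-ancestors {V} {node l k r} (inR S) m =
  ∈-++⁺ʳ (ancestors V l) (∈-++⁺ʳ (ancestorHere V (node l k r) k) (∈-ancestors S m))

key-sub : ∀ {x} A → x ∈ inorder A → ∃₂ λ l r → Sub (node l x r) A
key-sub (node l k r) x∈ with ∈-++⁻ (inorder l) x∈
... | inj₁ x∈l with key-sub l x∈l
...   | _ , _ , S = _ , _ , inL S
key-sub (node l k r) x∈ | inj₂ (here refl) = l , r , here
key-sub (node l k r) x∈ | inj₂ (there x∈r) with key-sub r x∈r
...   | _ , _ , S = _ , _ , inR S

IsAncestor : List ℕ → Tree → ℕ → Set
IsAncestor V A x = ∃₂ λ l r → Sub (node l x r) A × Meets V (node l x r)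

-- Chains and exposed spines: order, linearity and keys

preorder-chain : ∀ b {t} L {K Z} → (∀ x → markedPreorder (K (gap x)) ≡ Z) →
  markedPreorder (chain b (gap t) L K) ≡ map proj₁ L ++ Z
preorder-chain b     []            h = h _
preorder-chain true  ((u , g) ∷ L) h = cong (u ∷_) (preorder-chain true L h)
preorder-chain false ((u , g) ∷ L) h =
  cong (u ∷_) (trans (++-identityʳ _) (preorder-chain false L h))

linear-chain : ∀ b {t} L {K} → (∀ x → Linear (K (gap x))) → Linear (chain b (gap t) L K)
linear-chain b     []      h = h _
linear-chain true  (_ ∷ L) h = onR (linear-chain true L h)
linear-chain false (_ ∷ L) h = onL (linear-chain false L h)

expose-∈ : ∀ b t {L x} → x ∈ map proj₁ L → x ∈ map proj₁ (expose b t L)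
expose-∈ b     leaf         x∈ = x∈
expose-∈ true  (node l a r) x∈ = expose-∈ true l (there x∈)
expose-∈ false (node l a r) x∈ = expose-∈ false r (there x∈)

rearrange-sideNode : ∀ {P B} b {p t} → p ∉ P →
  rearrangeL P B (sideNode b leaf p t) ≡ sideNode b leaf p (rearrangeL P B t)
rearrange-sideNode {P} true  p∉P rewrite ∉ᵇ⁺ P p∉P = refl
rearrange-sideNode {P} false p∉P rewrite ∉ᵇ⁺ P p∉P = refl

expose-head : ∀ b l a r {L v h L′} → expose b (node l a r) L ≡ (v , h) ∷ L′ →
              v ∈ inorder (node l a r)
expose-head true leaf a r refl = here refl
expose-head true (node l₁ a₁ r₁) a r eq = ∈-++⁺ˡ (expose-head true l₁ a₁ r₁ eq)
expose-head false l a leaf refl = ∈-++⁺ʳ (inorder l) (here refl)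
expose-head false l a (node l₁ a₁ r₁) eq =
  ∈-++⁺ʳ (inorder l) (there (expose-head false l₁ a₁ r₁ eq))

-- Marked keys are ancestors in the after-tree

module _ (A : Tree) where

  -- Gaps remain literal subtrees of `A`. This is what allows a node of a gap, once it is marked, to
  -- be recognised as an ancestor in `A` itself and not merely in the current tree.
  SpineFrom : List ℕ → Spine → Set
  SpineFrom V = All λ (u , g) → Sub g A × IsAncestor V A u

  From : List ℕ → State → Set
  From V σ = ∀ b → Sub (outerGap σ b) A × SpineFrom V (spine σ b)

  spineFrom-mono : ∀ {V V′ L} → (∀ {x} → x ∈ V → x ∈ V′) → SpineFrom V L → SpineFrom V′ L
  spineFrom-mono V⊆ = All.map λ (S , l , r , S′ , m) → S , l , r , S′ , Any.map V⊆ m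

  -- The outer spine of `t` leads down to its outermost key `v`, so every node that gets marked has
  -- `v` in its subtree in `A`; since `v` is in `V`, it is an ancestor of `V`.
  expose-from : ∀ b t {V L v h L′} → expose b t L ≡ (v , h) ∷ L′ → v ∈ V →
                Sub t A → SpineFrom V L → SpineFrom V (expose b t L)
  expose-from b     leaf         eq v∈ S f = f
  expose-from true  (node l a r) eq v∈ S f = expose-from true l eq v∈ (sub-left S)
    ((sub-right S , l , r , S , Any.map (λ { refl → v∈ }) (expose-head true l a r eq)) ∷ f)
  expose-from false (node l a r) eq v∈ S f = expose-from false r eq v∈ (sub-right S)
    ((sub-left S , l , r , S , Any.map (λ { refl → v∈ }) (expose-head false l a r eq)) ∷ f)

  pop-from : ∀ b σ {V p h L} → SpineFrom V ((p , h) ∷ L) → From V σ →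
             From V (pop b ((p , h) ∷ L) σ)
  pop-from true  σ ((S , _) ∷ fL) f true  = S , fL
  pop-from true  σ ((S , _) ∷ fL) f false = f false
  pop-from false σ ((S , _) ∷ fL) f true  = f true
  pop-from false σ ((S , _) ∷ fL) f false = S , fL

  peel-from : ∀ b σ {V p h L} → expose b (outerGap σ b) (spine σ b) ≡ (p , h) ∷ L →
              From V σ → From (V ∷ʳ p) (peel b σ)
  peel-from b σ {V} {p} eq f =
    subst (λ S → From (V ∷ʳ p) (pop b S σ)) (sym eq)
      (pop-from b σ (subst (SpineFrom (V ∷ʳ p)) eq
        (expose-from b (outerGap σ b) eq (∈-++⁺ʳ V (here refl)) (proj₁ (f b)) (proj₂ (f′ b)))) f′)
    where
    f′ : From (V ∷ʳ p) σ
    f′ b = proj₁ (f b) , spineFrom-mono ∈-++⁺ˡ (proj₂ (f b))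

  spine-ancestors : ∀ {V L x} → SpineFrom V L → x ∈ map proj₁ L → x ∈ ancestors V A
  spine-ancestors ((_ , _ , _ , S , m) ∷ _) (here refl) = ∈-ancestors S m
  spine-ancestors (_ ∷ f)                   (there x∈)  = spine-ancestors f x∈

-- Trees and windows of the decomposition, and their conditions

module _ (s : ℕ) where

  markedKeys : State → List ℕ
  markedKeys σ = map proj₁ (spine σ true) ++ map proj₁ (spine σ false) ++ [ s ]

  preorder-current : ∀ σ → markedPreorder (current s σ) ≡ markedKeys σ
  preorder-current σ = preorder-chain true (spine σ true) λ x →
    preorder-chain false (spine σ false) λ y → refl

  linear-current : ∀ σ → Linear (current s σ)
  linear-current σ = linear-chain true (spine σ true) λ x →
    linear-chain false (spine σ false) λ y → end

  markedKeys-↭ : ∀ σ → marks (items (current s σ)) ↭ markedKeys σ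
  markedKeys-↭ σ = ↭-trans (marks↭markedPreorder (current s σ)) (↭-reflexive (preorder-current σ))

  marks-⊆-stateKeys : ∀ σ → marks (items (current s σ)) ⊆ stateKeys s σ
  marks-⊆-stateKeys σ = subst (marks (items (current s σ)) ⊆_)
    (sym (inorder-erase (current s σ))) (marks-⊆ (items (current s σ)))

  -- Exposing only adds marks and popping removes just `p`. The no-revisit condition rests on this
  -- monotonicity.
  peel-∈ : ∀ b σ {p h L x} → expose b (outerGap σ b) (spine σ b) ≡ (p , h) ∷ L →
           x ∈ markedKeys σ → x ∈ p ∷ markedKeys (peel b σ)
  peel-∈ true (state g S) {p} {h} {L} eq x∈ rewrite eq with ∈-++⁻ (map proj₁ (S true)) x∈
  ... | inj₁ x∈l = ∈-++⁺ˡ (subst (λ L → _ ∈ map proj₁ L) eq (expose-∈ true (g true) x∈l))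
  ... | inj₂ x∈r = there (∈-++⁺ʳ (map proj₁ L) x∈r)
  peel-∈ false (state g S) {p} {h} {L} eq x∈ rewrite eq with ∈-++⁻ (map proj₁ (S true)) x∈
  ... | inj₁ x∈l = there (∈-++⁺ˡ x∈l)
  ... | inj₂ x∈r with ∈-++⁻ (map proj₁ (S false)) x∈r
  ...   | inj₂ x∈s = there (∈-++⁺ʳ (map proj₁ (S true)) (∈-++⁺ʳ (map proj₁ L) x∈s))
  ...   | inj₁ x∈f with subst (λ L → _ ∈ map proj₁ L) eq (expose-∈ false (g false) x∈f)
  ...     | here x≡p = here x≡p
  ...     | there x∈L = there (∈-++⁺ʳ (map proj₁ (S true)) (∈-++⁺ˡ x∈L))

  s∈markedKeys : ∀ σ → s ∈ markedKeys σ
  s∈markedKeys σ =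
    ∈-++⁺ʳ (map proj₁ (spine σ true)) (∈-++⁺ʳ (map proj₁ (spine σ false)) (here refl))

  pathKeys : Dirs → List ℕ
  pathKeys ps = map proj₂ ps ++ [ s ]

  -- Depths count from the top of the path, so the decomposition runs through
  -- decreasing depths: windowAt d turns treeAt (suc d) into treeAt d. The lowest window [ s ]
  -- changes nothing; it is there to cover paths consisting of s alone.
  treeAt : Dirs → State → ℕ → Tree
  treeAt []             σ d       = erase (current s σ)
  treeAt (_ ∷ _)        σ zero    = erase (current s σ)
  treeAt ((b , p) ∷ ps) σ (suc d) = sideNode b leaf p (treeAt ps (peel b σ) d)

  windowAt : Dirs → State → ℕ → List ℕ
  windowAt []             σ d       = [ s ]
  windowAt ((b , p) ∷ ps) σ zero    = p ∷ markedKeys (peel b σ)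
  windowAt ((b , p) ∷ ps) σ (suc d) = windowAt ps (peel b σ) d

  afterAt : Dirs → State → ℕ → Tree
  afterAt []             σ d       = node leaf s leaf
  afterAt ((b , p) ∷ ps) σ zero    = topTree (exposed s b σ)
  afterAt ((b , p) ∷ ps) σ (suc d) = afterAt ps (peel b σ) d

  treeAt-zero : ∀ ps σ → treeAt ps σ 0 ≡ erase (current s σ)
  treeAt-zero []      σ = refl
  treeAt-zero (_ ∷ _) σ = refl

  dirTree-↭ : ∀ ps → inorder (dirTree s ps) ↭ pathKeys ps
  dirTree-↭ []             = ↭-refl
  dirTree-↭ ((b , p) ∷ ps) =
    ↭-trans (↭-reflexive (inorder-sideNode b p _))
    (↭-trans (join-↭ b [ p ] _) (prep p (dirTree-↭ ps)))

  -- Only the keys have to agree: the state arranges them as they are after processing, `dirTree` as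
  -- they are on the search path.
  record Valid (ps : Dirs) (σ : State) : Set where
    constructor valid
    field
      keys-eq : stateKeys s σ ≡ inorder (dirTree s ps)
      sorted  : Sorted (inorder (dirTree s ps))
  open Valid

  pathKeys-unique : ∀ {ps σ} → Valid ps σ → Unique (pathKeys ps)
  pathKeys-unique {ps} (valid _ srt) = Unique-resp-↭ (dirTree-↭ ps) (sorted-unique srt)

  s∈pathKeys : ∀ ps → s ∈ pathKeys ps
  s∈pathKeys ps = ∈-++⁺ʳ (map proj₂ ps) (here refl)

  fresh : ∀ {b p ps σ} → Valid ((b , p) ∷ ps) σ → p ∉ pathKeys ps
  fresh v with pathKeys-unique v
  ... | px ∷ _ = λ p∈ → All.lookup px p∈ refl

  peel-valid : ∀ {b p ps} σ → Valid ((b , p) ∷ ps) σ →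
    ∃₂ λ h L → expose b (outerGap σ b) (spine σ b) ≡ (p , h) ∷ L × Valid ps (peel b σ)
  peel-valid {b} {p} {ps} σ v@(valid eq srt)
    with peel-keys s b {p} {ps} σ (λ { refl → fresh v (s∈pathKeys ps) }) eq
  ... | h , L , e , eq′ = h , L , e ,
    valid eq′ (AllPairs-resp-⊆ (join-⊆ʳ b [ p ] _) (subst Sorted (inorder-sideNode b p _) srt))

  markedKeys⊆ : ∀ {ps σ x} → Valid ps σ → x ∈ markedKeys σ → x ∈ pathKeys ps
  markedKeys⊆ {ps} {σ} (valid eq _) x∈ =
    ∈-resp-↭ (dirTree-↭ ps) (subst (_ ∈_) eq
      (Sublist.lookup (marks-⊆-stateKeys σ) (∈-resp-↭ (↭-sym (markedKeys-↭ σ)) x∈)))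

  markedKeys-unique : ∀ {ps σ} → Valid ps σ → Unique (markedKeys σ)
  markedKeys-unique {ps} {σ} (valid eq srt) = Unique-resp-↭ (markedKeys-↭ σ)
    (AllPairs-resp-⊆ (marks-⊆-stateKeys σ) (subst Unique (sym eq) (sorted-unique srt)))

  current-[] : ∀ σ → Valid [] σ → erase (current s σ) ≡ node leaf s leaf
  current-[] σ (valid eq _) = single (erase (current s σ)) eq
    where
    empty : ∀ t → inorder t ≡ [] → t ≡ leaf
    empty leaf         _ = refl
    empty (node l k r) e with ++-conicalʳ (inorder l) _ e
    ... | ()
    single : ∀ t → inorder t ≡ [ s ] → t ≡ node leaf s leaf
    single (node l k r) e with inorder l in el
    single (node l k r) e  | [] with ∷-injective e
    ... | refl , er = cong₂ (λ l → node l s) (empty l el) (empty r er)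
    single (node l k r) e | x ∷ xs with ++-conicalʳ xs _ (∷-injectiveʳ e)
    ... | ()

  windowAt⊆ : ∀ ps σ d {x} → Valid ps σ → x ∈ windowAt ps σ d → x ∈ pathKeys ps
  windowAt⊆ []             σ d       v x∈ = x∈
  windowAt⊆ ((b , p) ∷ ps) σ d v x∈ with peel-valid σ v
  windowAt⊆ (_ ∷ ps) σ zero    v (here x≡p) | _ = here x≡p
  windowAt⊆ (_ ∷ ps) σ zero    v (there x∈) | _ , _ , _ , v′ = there (markedKeys⊆ v′ x∈)
  windowAt⊆ (_ ∷ ps) σ (suc d) v x∈ | _ , _ , _ , v′ = there (windowAt⊆ ps _ d v′ x∈)

  s∈windowAt : ∀ ps σ d → s ∈ windowAt ps σ d
  s∈windowAt []             σ d       = here refl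
  s∈windowAt ((b , p) ∷ ps) σ zero    = there (s∈markedKeys (peel b σ))
  s∈windowAt ((b , p) ∷ ps) σ (suc d) = s∈windowAt ps _ d

  treeAt-last : ∀ ps σ → Valid ps σ → treeAt ps σ (suc (length ps)) ≡ dirTree s ps
  treeAt-last []             σ v = current-[] σ v
  treeAt-last ((b , p) ∷ ps) σ v with peel-valid σ v
  ... | _ , _ , _ , v′ = cong (sideNode b leaf p) (treeAt-last ps _ v′)

  windowAt-path : ∀ ps σ d → Valid ps σ → d ≤ length ps →
                  DownPath (treeAt ps σ (suc d)) (windowAt ps σ d)
  windowAt-path [] σ d v _ rewrite current-[] σ v = top here
  windowAt-path ((b , p) ∷ ps) σ zero v _ rewrite treeAt-zero ps (peel b σ) =
    top (subst₂ StartsAt (erase-sideMk b (gap leaf) p M) (eq b) (linear-path (lin b)))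
    where
    M = current s (peel b σ)
    lin : ∀ b → Linear (sideMk b (gap leaf) p M)
    lin true  = onR (linear-current (peel _ σ))
    lin false = onL (linear-current (peel _ σ))
    eq : ∀ c → markedPreorder (sideMk c (gap leaf) p M) ≡ p ∷ markedKeys (peel b σ)
    eq true  = cong (p ∷_) (preorder-current (peel b σ))
    eq false = cong (p ∷_) (trans (++-identityʳ _) (preorder-current (peel b σ)))
  windowAt-path ((b , p) ∷ ps) σ (suc d) v (s≤s d≤) with peel-valid σ v
  windowAt-path ((true  , p) ∷ ps) σ (suc d) v (s≤s d≤) | _ , _ , _ , v′ =
    inR (windowAt-path ps _ d v′ d≤)
  windowAt-path ((false , p) ∷ ps) σ (suc d) v (s≤s d≤) | _ , _ , _ , v′ =
    inL (windowAt-path ps _ d v′ d≤)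

  marks-exposed : ∀ {b p ps σ} → Valid ((b , p) ∷ ps) σ →
                  marks (items (exposed s b σ)) ↭ p ∷ markedKeys (peel b σ)
  marks-exposed {b} {p} {ps} {σ} v with peel-valid σ v
  ... | h , L , e , _ =
    ↭-trans (↭-reflexive (cong marks (sym (peel-items s b σ e))))
    (↭-trans (marks↭markedPreorder (sideMk b (gap leaf) p (current s (peel b σ)))) (pre b))
    where
    pre : ∀ c → markedPreorder (sideMk c (gap leaf) p (current s (peel b σ))) ↭ p ∷ markedKeys (peel b σ)
    pre true  = prep p (↭-reflexive (preorder-current (peel b σ)))
    pre false = prep p (↭-reflexive (trans (++-identityʳ _) (preorder-current (peel b σ))))

  afterAt-sorted : ∀ ps σ d → Valid ps σ → d ≤ length ps → Sorted (inorder (afterAt ps σ d))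
  afterAt-sorted []             σ d       v _ = [] ∷ []
  afterAt-sorted ((b , p) ∷ ps) σ zero    (valid eq srt) _ =
    AllPairs-resp-⊆ (subst₂ _⊆_ (sym (inorder-topTree M)) M-keys (marks-⊆ (items M))) srt
    where
    M = exposed s b σ
    M-keys : concatMap itemKeys (items M) ≡ inorder (dirTree s ((b , p) ∷ ps))
    M-keys = trans (sym (inorder-erase M)) (trans (cong inorder (erase-exposed s b σ)) eq)
  afterAt-sorted ((b , p) ∷ ps) σ (suc d) v (s≤s d≤) with peel-valid σ v
  ... | _ , _ , _ , v′ = afterAt-sorted ps _ d v′ d≤

  afterAt-↭ : ∀ ps σ d → Valid ps σ → d ≤ length ps → inorder (afterAt ps σ d) ↭ windowAt ps σ d
  afterAt-↭ []             σ d       v _ = ↭-refl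
  afterAt-↭ ((b , p) ∷ ps) σ zero    v _ =
    ↭-trans (↭-reflexive (inorder-topTree (exposed s b σ))) (marks-exposed v)
  afterAt-↭ ((b , p) ∷ ps) σ (suc d) v (s≤s d≤) with peel-valid σ v
  ... | _ , _ , _ , v′ = afterAt-↭ ps _ d v′ d≤

  windowAt-step : ∀ ps σ d → Valid ps σ → d ≤ length ps →
    treeAt ps σ d ≡ rearrangeL (windowAt ps σ d) (afterAt ps σ d) (treeAt ps σ (suc d))
  windowAt-step [] σ d v _
    rewrite current-[] σ v | ∈ᵇ⁺ {s} {[ s ]} (here refl) = refl
  windowAt-step ((b , p) ∷ ps) σ zero v _ rewrite treeAt-zero ps (peel b σ) with peel-valid σ v
  ... | h , L , e , _ = sym (begin
    rearrangeL P B (sideNode b leaf p (erase N))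
      ≡⟨ cong (rearrangeL P B) (sym (erase-sideMk b (gap leaf) p N)) ⟩
    rearrangeL P B (erase (sideMk b (gap leaf) p N))
      ≡⟨ rearr b (peel-items s b σ e) ⟩
    erase (exposed s b σ)
      ≡⟨ erase-exposed s b σ ⟩
    erase (current s σ) ∎)
    where
    open ≡-Reasoning
    P = p ∷ markedKeys (peel b σ)
    B = topTree (exposed s b σ)
    N = current s (peel b σ)
    unique : ∀ M → items M ≡ items (exposed s b σ) → Unique (inorder (erase M))
    unique M eq = subst Unique (sym (trans (inorder-erase M)
        (trans (cong (concatMap itemKeys) eq) (trans (sym (inorder-erase (exposed s b σ)))
          (trans (cong inorder (erase-exposed s b σ)) (keys-eq v))))))
      (sorted-unique (sorted v))
    rearr : ∀ c → items (sideMk c (gap leaf) p N) ≡ items (exposed s b σ) →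
            rearrangeL P B (erase (sideMk c (gap leaf) p N)) ≡ erase (exposed s b σ)
    rearr true  eq = rearrange-items {l = gap leaf} {p} {N} (exposed s b σ) eq
      (marks-exposed v) (unique (mk (gap leaf) p N) eq)
    rearr false eq = rearrange-items {l = N} {p} {gap leaf} (exposed s b σ) eq
      (marks-exposed v) (unique (mk N p (gap leaf)) eq)
  windowAt-step ((b , p) ∷ ps) σ (suc d) v (s≤s d≤) with peel-valid σ v
  -- The window lies among the path keys below `p`, so `rearrange` passes `p` by and acts in its
  -- inner subtree.
  ... | _ , _ , _ , v′ = trans (cong (sideNode b leaf p) (windowAt-step ps _ d v′ d≤))
    (sym (rearrange-sideNode b (λ p∈ → fresh v (windowAt⊆ ps _ d v′ p∈))))

  -- The new key is the path key at depth `d`: deeper windows contain only keys from further down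
  -- the search path.
  windowAt-progress : ∀ ps σ d → Valid ps σ → d < length ps →
    ∃ λ x → x ∈ windowAt ps σ d × x ∉ windowAt ps σ (suc d)
  windowAt-progress ((b , p) ∷ ps) σ d v d< with peel-valid σ v
  windowAt-progress ((b , p) ∷ ps) σ zero v _ | _ , _ , _ , v′ =
    p , here refl , fresh v ∘ windowAt⊆ ps _ 0 v′
  windowAt-progress ((b , p) ∷ ps) σ (suc d) v (s≤s d<) | _ , _ , _ , v′ =
    windowAt-progress ps _ d v′ d<

  marked-persists : ∀ ps σ d {x} → Valid ps σ →
    x ∈ markedKeys σ → x ∈ windowAt ps σ (suc d) → x ∈ windowAt ps σ d
  marked-persists []             σ d       v x∈m x∈w = x∈w
  marked-persists ((b , p) ∷ ps) σ d v x∈m x∈w with peel-valid σ v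
  marked-persists ((b , p) ∷ ps) σ zero v x∈m x∈w | _ , _ , e , _ = peel-∈ b σ e x∈m
  marked-persists ((b , p) ∷ ps) σ (suc d) v x∈m x∈w | _ , _ , e , v′ with peel-∈ b σ e x∈m
  ... | here refl  = contradiction (windowAt⊆ ps _ (suc d) v′ x∈w) (fresh v)
  ... | there x∈m′ = marked-persists ps _ d v′ x∈m′ x∈w

  -- No-revisit by contraposition, with larger depth meaning earlier time. The path key at depth `e`
  -- is in no deeper window, so `x` is marked just below depth `e`. Going deeper, it stays marked
  -- until it is peeled itself, and its presence at depth `suc d` shows that this has not happened
  -- by depth `d`.
  windowAt-persists : ∀ ps σ {e d x} → Valid ps σ → e < d →
    x ∈ windowAt ps σ e → x ∈ windowAt ps σ (suc d) → x ∈ windowAt ps σ d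
  windowAt-persists []             σ v e<d x∈e x∈ = x∈
  windowAt-persists ((b , p) ∷ ps) σ {e} v e<d x∈e x∈ with peel-valid σ v
  windowAt-persists ((b , p) ∷ ps) σ {zero} {suc d} v _ (here refl) x∈ | _ , _ , _ , v′ =
    contradiction (windowAt⊆ ps _ (suc d) v′ x∈) (fresh v)
  windowAt-persists ((b , p) ∷ ps) σ {zero} {suc d} v _ (there x∈m) x∈ | _ , _ , _ , v′ =
    marked-persists ps _ d v′ x∈m x∈
  windowAt-persists ((b , p) ∷ ps) σ {suc e} {suc d} v (s≤s e<d) x∈e x∈ | _ , _ , _ , v′ =
    windowAt-persists ps _ v′ e<d x∈e x∈

  module _ (A : Tree) where

    markedKeys-ancestors : ∀ {V σ} → IsAncestor V A s → From A V σ →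
      ∀ {x} → x ∈ markedKeys σ → x ∈ ancestors V A
    markedKeys-ancestors {V} {σ} (_ , _ , S , m) f x∈ with ∈-++⁻ (map proj₁ (spine σ true)) x∈
    ... | inj₁ x∈l = spine-ancestors A (proj₂ (f true)) x∈l
    ... | inj₂ x∈r with ∈-++⁻ (map proj₁ (spine σ false)) x∈r
    ...   | inj₁ x∈f         = spine-ancestors A (proj₂ (f false)) x∈f
    ...   | inj₂ (here refl) = ∈-ancestors S m

    -- Let `V` be `pre` followed by `p`, and `U` the marked keys below `p`. All of them are
    -- ancestors of `V` in `A`: a key of `V` of itself, a spine key by `From`, and `s` by the last
    -- hypothesis. `U` lies among the path keys below `p` and is therefore disjoint from `V`, so the
    -- bound leaves at most `c` keys for `U`; `p` is the one extra. The bound is assumed for all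
    -- prefixes so that it survives the recursion.
    windowAt-length : ∀ {c} pre ps σ d → Valid ps σ → From A pre σ →
      (∀ V rest → pre ++ map proj₂ ps ≡ V ++ rest → length (ancestors V A) ≤ length V + c) →
      Unique (pre ++ pathKeys ps) → (∀ {x} → x ∈ pre ++ pathKeys ps → x ∈ inorder A) →
      (∀ {V x} → x ∈ V → x ∈ inorder A → IsAncestor V A s) →
      length (windowAt ps σ d) ≤ suc c
    windowAt-length pre [] σ d v f bnd u sub anc = s≤s z≤n
    windowAt-length {c} pre ((b , p) ∷ ps) σ d v f bnd u sub anc with peel-valid σ v
    windowAt-length {c} pre ((b , p) ∷ ps) σ (suc d) v f bnd u sub anc | _ , _ , e , v′ =
      windowAt-length (pre ∷ʳ p) ps (peel b σ) d v′ (peel-from A b σ e f)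
        (λ V rest eq → bnd V rest (trans (sym (++-assoc pre [ p ] _)) eq))
        (subst Unique assoc u) (λ x∈ → sub (subst (_ ∈_) (sym assoc) x∈)) anc
      where
      assoc = sym (++-assoc pre [ p ] (pathKeys ps))
    windowAt-length {c} pre ((b , p) ∷ ps) σ zero v f bnd u sub anc | _ , _ , e , v′ =
      s≤s (ℕ.+-cancelˡ-≤ (length V) _ _ (begin
        length V + length U         ≡⟨ sym (length-++ V) ⟩
        length (V ++ U)             ≤⟨ unique-⊆-length uVU VU⊆ ⟩
        length (ancestors V A)      ≤⟨ bnd V (map proj₂ ps) (sym (++-assoc pre [ p ] _)) ⟩
        length V + c                ∎))
      where
      open ℕ.≤-Reasoning
      V = pre ∷ʳ p
      U = markedKeys (peel b σ)
      assoc = sym (++-assoc pre [ p ] (pathKeys ps))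
      u′ : Unique (V ++ pathKeys ps)
      u′ = subst Unique assoc u
      V⊆A : ∀ {x} → x ∈ V → x ∈ inorder A
      V⊆A x∈ = sub (subst (_ ∈_) (sym assoc) (∈-++⁺ˡ x∈))
      uVU : Unique (V ++ U)
      uVU = Unique.++⁺ (AllPairs-resp-⊆ (⊆-++⁺ʳ (pathKeys ps) ⊆-refl) u′)
              (markedKeys-unique v′)
              (λ (x∈V , x∈U) → AllPairs-++-cross V u′ x∈V (markedKeys⊆ v′ x∈U) refl)
      p∈V : p ∈ V
      p∈V = ∈-++⁺ʳ pre (here refl)
      VU⊆ : ∀ {x} → x ∈ V ++ U → x ∈ ancestors V A
      VU⊆ x∈ with ∈-++⁻ V x∈
      ... | inj₁ x∈V with key-sub A (V⊆A x∈V)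
      ...   | l , r , S = ∈-ancestors S (Any.map (λ { refl → x∈V }) (∈-++⁺ʳ (inorder l) (here refl)))
      VU⊆ x∈ | inj₂ x∈U = markedKeys-ancestors (anc p∈V (V⊆A p∈V)) (peel-from A b σ e f) x∈U

-- Transfer of weights and potentials from the rationals to the naturals

-- Given directly in lowest terms, so that numerators and denominators compute; `fromℕ 2` and `two`
-- then agree by definition.
fromℕ : ℕ → ℚ
fromℕ n = mkℚ (+ n) 0 (Coprime.sym (Coprime.1-coprimeTo n))

fromℕ-+ : ∀ m n → fromℕ (m + n) ≡ fromℕ m ℚ.+ fromℕ n
fromℕ-+ m n = ℚ.toℚᵘ-injective (ℚᵘ.≃-sym (ℚᵘ.≃-trans (ℚ.toℚᵘ-homo-+ (fromℕ m) (fromℕ n))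
  (*≡* (cong (ℤ._* (+ 1)) (cong₂ ℤ._+_ (ℤ.*-identityʳ (+ m)) (ℤ.*-identityʳ (+ n)))))))

fromℕ-* : ∀ m n → fromℕ (m * n) ≡ fromℕ m ℚ.* fromℕ n
fromℕ-* m n = ℚ.toℚᵘ-injective (ℚᵘ.≃-sym (ℚᵘ.≃-trans (ℚ.toℚᵘ-homo-* (fromℕ m) (fromℕ n))
  (*≡* (cong (ℤ._* (+ 1)) (sym (ℤ.pos-* m n))))))

fromℕ-^ : ∀ m k → fromℕ (m ^ k) ≡ fromℕ m ^ℚ k
fromℕ-^ m zero    = refl
fromℕ-^ m (suc k) = trans (fromℕ-* m (m ^ k)) (cong (fromℕ m ℚ.*_) (fromℕ-^ m k))

fromℕ-cancel-≤ : ∀ {m n} → fromℕ m ℚ.≤ fromℕ n → m ≤ n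
fromℕ-cancel-≤ {m} {n} (ℚ.*≤* le) =
  ℤ.drop‿+≤+ (subst₂ ℤ._≤_ (ℤ.*-identityʳ (+ m)) (ℤ.*-identityʳ (+ n)) le)

weightℕ : (ℕ → ℕ) → Tree → ℕ
weightℕ w leaf         = 0
weightℕ w (node l k r) = weightℕ w l + (w k + weightℕ w r)

expΦℕ : (ℕ → ℕ) → Tree → ℕ
expΦℕ w leaf         = 1
expΦℕ w (node l k r) = weightℕ w (node l k r) * (expΦℕ w l * expΦℕ w r)

fromℕ-weight : ∀ w t → fromℕ (weightℕ w t) ≡ weight (fromℕ ∘ w) t
fromℕ-weight w leaf         = refl
fromℕ-weight w (node l k r) =
  trans (fromℕ-+ (weightℕ w l) (w k + weightℕ w r))
    (cong₂ ℚ._+_ (fromℕ-weight w l)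
      (trans (fromℕ-+ (w k) (weightℕ w r)) (cong (fromℕ (w k) ℚ.+_) (fromℕ-weight w r))))

fromℕ-expΦ : ∀ w t → fromℕ (expΦℕ w t) ≡ expΦ (fromℕ ∘ w) t
fromℕ-expΦ w leaf         = refl
fromℕ-expΦ w t@(node l k r) =
  trans (fromℕ-* (weightℕ w t) (expΦℕ w l * expΦℕ w r))
    (cong₂ ℚ._*_ (fromℕ-weight w t)
      (trans (fromℕ-* (expΦℕ w l) (expΦℕ w r)) (cong₂ ℚ._*_ (fromℕ-expΦ w l) (fromℕ-expΦ w r))))

-- Potential estimates for heavy keys

size : Tree → ℕ
size = length ∘ inorder

size-node : ∀ l k r → size (node l k r) ≡ size l + (1 + size r)
size-node l k r = length-++ (inorder l)

length-ancestors : ∀ V l k r → length (ancestors V (node l k r)) ≡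
  length (ancestors V l) + (length (ancestorHere V (node l k r) k) + length (ancestors V r))
length-ancestors V l k r = trans (length-++ (ancestors V l))
  (cong (λ n → length (ancestors V l) + n) (length-++ (ancestorHere V (node l k r) k)))

module _ (V : List ℕ) (M : ℕ) (1≤M : 1 ≤ M) where

  heavy : ℕ → ℕ
  heavy k = if does (k ∈? V) then M else 1

  heavy-≥1 : ∀ k → 1 ≤ heavy k
  heavy-≥1 k with k ∈? V
  ... | yes _ = 1≤M
  ... | no  _ = ℕ.≤-refl

  heavy-≤M : ∀ k → heavy k ≤ M
  heavy-≤M k with k ∈? V
  ... | yes _ = ℕ.≤-refl
  ... | no  _ = 1≤M

  heavy-∈ : ∀ {k} → k ∈ V → heavy k ≡ M
  heavy-∈ {k} k∈ with k ∈? V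
  ... | yes _  = refl
  ... | no k∉ = contradiction k∈ k∉

  heavy-∉ : ∀ {k} → k ∉ V → heavy k ≡ 1
  heavy-∉ {k} k∉ with k ∈? V
  ... | yes k∈ = contradiction k∈ k∉
  ... | no _   = refl

  weight-≤ : ∀ c t → (∀ {k} → k ∈ inorder t → heavy k ≤ c) → weightℕ heavy t ≤ size t * c
  weight-≤ c leaf         h = z≤n
  weight-≤ c (node l k r) h rewrite size-node l k r | ℕ.*-distribʳ-+ c (size l) (1 + size r) =
    ℕ.+-mono-≤ (weight-≤ c l (h ∘ ∈-++⁺ˡ))
      (ℕ.+-mono-≤ (h (∈-++⁺ʳ (inorder l) (here refl)))
                  (weight-≤ c r (h ∘ ∈-++⁺ʳ (inorder l) ∘ there)))

  weight-≥ : ∀ {k} t → k ∈ inorder t → heavy k ≤ weightℕ heavy t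
  weight-≥ (node l k r) x∈ with ∈-++⁻ (inorder l) x∈
  ... | inj₁ x∈l = ℕ.m≤n⇒m≤n+o _ (weight-≥ l x∈l)
  ... | inj₂ (here refl) = ℕ.m≤n⇒m≤o+n (weightℕ heavy l) (ℕ.m≤m+n _ _)
  ... | inj₂ (there x∈r) =
    ℕ.m≤n⇒m≤o+n (weightℕ heavy l) (ℕ.m≤n⇒m≤o+n (heavy k) (weight-≥ r x∈r))

  weight-here-≤ : ∀ {N} t k → size t ≤ N → weightℕ heavy t ≤ N * M ^ length (ancestorHere V t k)
  weight-here-≤ {N} t k s≤N with meets? V t
  ... | yes _ = ℕ.≤-trans (weight-≤ M t (λ {k} _ → heavy-≤M k))
                  (ℕ.*-mono-≤ s≤N (ℕ.≤-reflexive (sym (ℕ.*-identityʳ M))))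
  ... | no ¬m = ℕ.≤-trans
    (weight-≤ 1 t (λ k∈t → ℕ.≤-reflexive (heavy-∉ (λ k∈V → ¬m (Any.map (λ { refl → k∈V }) k∈t)))))
    (ℕ.*-monoˡ-≤ 1 s≤N)

  here-≤-weight : ∀ l k r → M ^ length (ancestorHere V (node l k r) k) ≤ weightℕ heavy (node l k r)
  here-≤-weight l k r with meets? V (node l k r)
  ... | no _ = ℕ.≤-trans (heavy-≥1 k) (weight-≥ (node l k r) (∈-++⁺ʳ (inorder l) (here refl)))
  ... | yes m with find m
  ...   | x , x∈t , x∈V = ℕ.≤-trans (ℕ.≤-reflexive (trans (ℕ.*-identityʳ M) (sym (heavy-∈ x∈V))))
                                    (weight-≥ (node l k r) x∈t)

  expΦ-≥1 : ∀ t → 1 ≤ expΦℕ heavy t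
  expΦ-≥1 leaf         = ℕ.≤-refl
  expΦ-≥1 (node l k r) = ℕ.*-mono-≤
    (ℕ.≤-trans (heavy-≥1 k) (weight-≥ (node l k r) (∈-++⁺ʳ (inorder l) (here refl))))
    (ℕ.*-mono-≤ (expΦ-≥1 l) (expΦ-≥1 r))

  pow-split : ∀ a b c → M ^ (a + (b + c)) ≡ M ^ b * (M ^ a * M ^ c)
  pow-split a b c
    rewrite ℕ.^-distribˡ-+-* M a (b + c) | ℕ.^-distribˡ-+-* M b c =
    swap (M ^ a) (M ^ b) (M ^ c)
    where
    swap : ∀ x y z → x * (y * z) ≡ y * (x * z)
    swap = solve-∀

  -- Each node contributes a factor of at most `N`, times `M` if a heavy key lies in its subtree.
  -- `N` stays the same throughout the recursion so that the powers can be collected.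
  expΦ-≤ : ∀ {N} t → size t ≤ N → expΦℕ heavy t ≤ N ^ size t * M ^ length (ancestors V t)
  expΦ-≤ {N} leaf _ = ℕ.≤-refl
  expΦ-≤ {N} t@(node l k r) s≤N
    rewrite length-ancestors V l k r | size-node l k r
          | pow-split (length (ancestors V l)) (length (ancestorHere V t k)) (length (ancestors V r))
          | ℕ.^-distribˡ-+-* N (size l) (1 + size r) = begin
    weightℕ heavy t * (expΦℕ heavy l * expΦℕ heavy r)
      ≤⟨ ℕ.*-mono-≤ (weight-here-≤ t k (subst (_≤ N) (sym (size-node l k r)) s≤N))
           (ℕ.*-mono-≤ (expΦ-≤ l (ℕ.m+n≤o⇒m≤o _ s≤N))
                       (expΦ-≤ r (ℕ.≤-trans (ℕ.n≤1+n _) (ℕ.m+n≤o⇒n≤o (size l) s≤N)))) ⟩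
    (N * H) * ((N ^ size l * L) * (N ^ size r * R))
      ≡⟨ regroup N H (N ^ size l) L (N ^ size r) R ⟩
    N ^ size l * (N * N ^ size r) * (H * (L * R)) ∎
    where
    open ℕ.≤-Reasoning
    H = M ^ length (ancestorHere V t k)
    L = M ^ length (ancestors V l)
    R = M ^ length (ancestors V r)
    regroup : ∀ n h a l b r → (n * h) * ((a * l) * (b * r)) ≡ a * (n * b) * (h * (l * r))
    regroup = solve-∀

  weight-plug : ∀ B ts → weightℕ heavy B ≤ weightℕ heavy (proj₁ (plug B ts))
  weight-plug leaf []       = z≤n
  weight-plug leaf (_ ∷ _)  = z≤n
  weight-plug (node l k r) ts with plug l ts | weight-plug l ts
  ... | l′ , ts₁ | p with plug r ts₁ | weight-plug r ts₁
  ...   | r′ , ts₂ | q = ℕ.+-mono-≤ p (ℕ.+-monoʳ-≤ (heavy k) q)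

  -- Plugging subtrees in only adds weight to the nodes of `B`, and each plugged subtree contributes
  -- a factor of at least 1. Hence ancestors may be counted in `B` alone.
  expΦ-plug-≥ : ∀ B ts → M ^ length (ancestors V B) ≤ expΦℕ heavy (proj₁ (plug B ts))
  expΦ-plug-≥ leaf []      = ℕ.≤-refl
  expΦ-plug-≥ leaf (t ∷ _) = expΦ-≥1 t
  expΦ-plug-≥ (node l k r) ts
    rewrite length-ancestors V l k r
          | pow-split (length (ancestors V l)) (length (ancestorHere V (node l k r) k)) (length (ancestors V r))
    with plug l ts | weight-plug l ts | expΦ-plug-≥ l ts
  ... | l′ , ts₁ | pw | pe with plug r ts₁ | weight-plug r ts₁ | expΦ-plug-≥ r ts₁
  ...   | r′ , ts₂ | qw | qe = ℕ.*-mono-≤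
    (ℕ.≤-trans (here-≤-weight l k r) (ℕ.+-mono-≤ pw (ℕ.+-monoʳ-≤ (heavy k) qw)))
    (ℕ.*-mono-≤ pe qe)

-- Search paths and sorted key lists

searchPath-∷ : ∀ l k r s → ∃ λ P → searchPath (node l k r) s ≡ k ∷ P
searchPath-∷ l k r s with s <ᵇ k | k <ᵇ s
... | true  | _     = _ , refl
... | false | true  = _ , refl
... | false | false = _ , refl

searchPath⊆ : ∀ t s {x} → x ∈ searchPath t s → x ∈ inorder t
searchPath⊆ (node l k r) s x∈ with s <ᵇ k | k <ᵇ s
searchPath⊆ (node l k r) s (here refl) | true  | _     = ∈-++⁺ʳ (inorder l) (here refl)
searchPath⊆ (node l k r) s (there x∈)  | true  | _     = ∈-++⁺ˡ (searchPath⊆ l s x∈)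
searchPath⊆ (node l k r) s (here refl) | false | true  = ∈-++⁺ʳ (inorder l) (here refl)
searchPath⊆ (node l k r) s (there x∈)  | false | true  = ∈-++⁺ʳ (inorder l) (there (searchPath⊆ r s x∈))
searchPath⊆ (node l k r) s (here refl) | false | false = ∈-++⁺ʳ (inorder l) (here refl)

sorted-left : ∀ l k r → Sorted (inorder (node l k r)) → Sorted (inorder l)
sorted-left l k r = AllPairs-resp-⊆ (⊆-++⁺ʳ (k ∷ inorder r) ⊆-refl)

sorted-right : ∀ l k r → Sorted (inorder (node l k r)) → Sorted (inorder r)
sorted-right l k r = AllPairs-resp-⊆ (⊆-++⁺ˡ (inorder l) (k Sublist.∷ʳ ⊆-refl))

left-< : ∀ l k r → Sorted (inorder (node l k r)) → ∀ {x} → x ∈ inorder l → x < k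
left-< l k r srt x∈ = AllPairs-++-cross (inorder l) srt x∈ (here refl)

right-> : ∀ l k r → Sorted (inorder (node l k r)) → ∀ {x} → x ∈ inorder r → k < x
right-> l k r srt x∈ = All.lookup (AllPairs.head (AllPairs-resp-⊆ (⊆-++⁺ˡ (inorder l) ⊆-refl) srt)) x∈

ancestors-[] : ∀ V t → (∀ {x} → x ∈ inorder t → x ∉ V) → ancestors V t ≡ []
ancestors-[] V leaf         h = refl
ancestors-[] V (node l k r) h
  rewrite ancestors-[] V l (h ∘ ∈-++⁺ˡ)
        | ancestors-[] V r (h ∘ ∈-++⁺ʳ (inorder l) ∘ there)
  with meets? V (node l k r)
... | no _  = refl
... | yes m with find m
...   | _ , x∈t , x∈V = contradiction x∈V (h x∈t)


length-ancestorHere : ∀ V t k → length (ancestorHere V t k) ≤ 1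
length-ancestorHere V t k with meets? V t
... | yes _ = ℕ.≤-refl
... | no  _ = z≤n

ancestors-node-≤ : ∀ V l k r {a b} → length (ancestors V l) ≤ a → length (ancestors V r) ≤ b →
                   length (ancestors V (node l k r)) ≤ a + (1 + b)
ancestors-node-≤ V l k r p q rewrite length-ancestors V l k r =
  ℕ.+-mono-≤ p (ℕ.+-mono-≤ (length-ancestorHere V (node l k r) k) q)

ancestors-none : ∀ V t → (∀ {x} → x ∈ inorder t → x ∉ V) → length (ancestors V t) ≤ 0
ancestors-none V t h = ℕ.≤-reflexive (cong length (ancestors-[] V t h))

-- Every ancestor in t of a key on the search path lies on the search path above it.
path-ancestors : ∀ V t s {Pre Post} → Sorted (inorder t) → searchPath t s ≡ Pre ++ Post →
  (∀ {x} → x ∈ inorder t → x ∈ V → x ∈ Pre) → length (ancestors V t) ≤ length Pre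
path-ancestors V leaf s srt eq h = z≤n
path-ancestors V t@(node _ _ _) s {[]} srt eq h =
  ancestors-none V t (λ x∈t x∈V → contradiction (h x∈t x∈V) λ ())
path-ancestors V t@(node l k r) s {q ∷ Pre} srt eq h with s <ᵇ k | k <ᵇ s
... | true | _ with ∷-injective eq
...   | refl , eq′ = ℕ.≤-trans
  (ancestors-node-≤ V l k r (path-ancestors V l s (sorted-left l k r srt) eq′ h′)
    (ancestors-none V r (λ x∈r x∈V → none x∈r (h (∈-++⁺ʳ (inorder l) (there x∈r)) x∈V))))
  (ℕ.≤-reflexive (ℕ.+-comm (length Pre) 1))
  where
  none : ∀ {x} → x ∈ inorder r → x ∉ k ∷ Pre
  none x∈r (here refl) = ℕ.<-irrefl refl (right-> l k r srt x∈r)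
  none x∈r (there x∈P) = ℕ.<-asym (right-> l k r srt x∈r)
    (left-< l k r srt (searchPath⊆ l s (subst (_ ∈_) (sym eq′) (∈-++⁺ˡ x∈P))))
  h′ : ∀ {x} → x ∈ inorder l → x ∈ V → x ∈ Pre
  h′ x∈l x∈V with h (∈-++⁺ˡ x∈l) x∈V
  ... | here refl = contradiction (left-< l k r srt x∈l) (ℕ.<-irrefl refl)
  ... | there x∈P = x∈P
path-ancestors V t@(node l k r) s {q ∷ Pre} srt eq h | false | true with ∷-injective eq
... | refl , eq′ = ancestors-node-≤ V l k r
  (ancestors-none V l (λ x∈l x∈V → none x∈l (h (∈-++⁺ˡ x∈l) x∈V)))
  (path-ancestors V r s (sorted-right l k r srt) eq′ h′)
  where
  none : ∀ {x} → x ∈ inorder l → x ∉ k ∷ Pre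
  none x∈l (here refl) = ℕ.<-irrefl refl (left-< l k r srt x∈l)
  none x∈l (there x∈P) = ℕ.<-asym (left-< l k r srt x∈l)
    (right-> l k r srt (searchPath⊆ r s (subst (_ ∈_) (sym eq′) (∈-++⁺ˡ x∈P))))
  h′ : ∀ {x} → x ∈ inorder r → x ∈ V → x ∈ Pre
  h′ x∈r x∈V with h (∈-++⁺ʳ (inorder l) (there x∈r)) x∈V
  ... | here refl = contradiction (right-> l k r srt x∈r) (ℕ.<-irrefl refl)
  ... | there x∈P = x∈P
path-ancestors V t@(node l k r) s {q ∷ Pre} srt eq h | false | false with ∷-injective eq
... | refl , eq′ with ++-conicalˡ Pre _ (sym eq′)
...   | refl = ancestors-node-≤ V l k r
  (ancestors-none V l (λ x∈l x∈V → none (left-< l k r srt x∈l) (h (∈-++⁺ˡ x∈l) x∈V)))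
  (ancestors-none V r (λ x∈r x∈V → none′ (right-> l k r srt x∈r) (h (∈-++⁺ʳ (inorder l) (there x∈r)) x∈V)))
  where
  none : ∀ {x} → x < k → x ∉ k ∷ []
  none x<k (here refl) = ℕ.<-irrefl refl x<k
  none′ : ∀ {x} → k < x → x ∉ k ∷ []
  none′ k<x (here refl) = ℕ.<-irrefl refl k<x

search-dirs : ∀ t s → Sorted (inorder t) → s ∈ inorder t → ∃ λ ps →
  searchPath t s ≡ pathKeys s ps × pathTree t s ≡ dirTree s ps × inorder (dirTree s ps) ⊆ inorder t
search-dirs (node l k r) s srt s∈ with s <ᵇ k in s<k | k <ᵇ s in k<s
... | true | _ with ∈-++⁻ (inorder l) s∈
...   | inj₂ (here refl) =
  contradiction (ℕ.<ᵇ⇒< s s (Equivalence.from T-≡ s<k)) (ℕ.<-irrefl refl)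
...   | inj₂ (there s∈r) =
  contradiction (right-> l k r srt s∈r) (ℕ.<-asym (ℕ.<ᵇ⇒< s k (Equivalence.from T-≡ s<k)))
...   | inj₁ s∈l with search-dirs l s (sorted-left l k r srt) s∈l
...     | ps , eqP , eqT , sub =
  (false , k) ∷ ps , cong (k ∷_) eqP , cong (λ t → node t k leaf) eqT ,
  ⊆-++⁺ sub (refl ∷ Sublist.minimum (inorder r))
search-dirs (node l k r) s srt s∈ | false | true with ∈-++⁻ (inorder l) s∈
... | inj₂ (here refl) =
  contradiction (ℕ.<ᵇ⇒< s s (Equivalence.from T-≡ k<s)) (ℕ.<-irrefl refl)
... | inj₁ s∈l =
  contradiction (left-< l k r srt s∈l) (ℕ.<-asym (ℕ.<ᵇ⇒< k s (Equivalence.from T-≡ k<s)))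
... | inj₂ (there s∈r) with search-dirs r s (sorted-right l k r srt) s∈r
...   | ps , eqP , eqT , sub =
  (true , k) ∷ ps , cong (k ∷_) eqP , cong (node leaf k) eqT ,
  ⊆-++⁺ˡ (inorder l) (refl ∷ sub)
search-dirs (node l k r) s srt s∈ | false | false 
  with ℕ.≤-antisym (ℕ.≮⇒≥ {s} {k} (λ lt → subst T s<k (ℕ.<⇒<ᵇ lt)))
                    (ℕ.≮⇒≥ {k} {s} (λ lt → subst T k<s (ℕ.<⇒<ᵇ lt)))
... | refl = [] , refl , refl , ⊆-++⁺ˡ (inorder l) (refl ∷ Sublist.minimum (inorder r))

sorted-keys : ∀ n → Sorted (keys n)
sorted-keys n = AllPairs.map⁺ (AllPairs.applyUpTo⁺₁ (λ i → i) n (λ i<j _ → s≤s i<j))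

∈-keys : ∀ {n s} → 1 ≤ s → s ≤ n → s ∈ keys n
∈-keys (s≤s {n = s} _) s<n = ∈-map⁺ suc (∈-upTo⁺ s<n)

sorted-↭⇒≡ : ∀ {xs ys} → Sorted xs → Sorted ys → xs ↭ ys → xs ≡ ys
sorted-↭⇒≡ sx sy p = Pointwise-≡⇒≡ (↗↭↗⇒≋ ℕ.≤-totalOrder (weaken sx) (weaken sy) (↭⇒↭ₛ p))
  where
  weaken : ∀ {xs} → Sorted xs → Linked _≤_ xs
  weaken = Linked.map ℕ.<⇒≤ ∘ AllPairs⇒Linked

-- The access lemma bounds ancestors in the after-tree

heavy-positive : ∀ V K k → ℚ.Positive (fromℕ (heavy V (suc K) (s≤s z≤n) k))
heavy-positive V K k with heavy V (suc K) (s≤s z≤n) k | heavy-≥1 V (suc K) (s≤s z≤n) k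
... | suc _ | _ = _

^-distribʳ-* : ∀ a b c → (a * b) ^ c ≡ a ^ c * b ^ c
^-distribʳ-* a b zero    = refl
^-distribʳ-* a b (suc c) = trans (cong (a * b *_) (^-distribʳ-* a b c)) (interchange a b (a ^ c) (b ^ c))
  where
  interchange : ∀ a b x y → a * b * (x * y) ≡ a * x * (b * y)
  interchange = solve-∀

-- In `T`, an initial segment `V` of the search path accounts for all of its ancestors, so the
-- potential before the access has at most `M ^ length V`; the total weight contributes at most
-- `M ^ c`. The potential afterwards has at least one factor `M` for every ancestor in `A`.
ancestors-bound : ∀ 𝒜 ((c , _) : AccessLemmaSOL 𝒜) n T s A {V rest} → IsBSTOnN n T →
  1 ≤ s → s ≤ n → MinSelfAdjusting.after 𝒜 n T s A → searchPath T s ≡ V ++ rest →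
  length (ancestors V A) ≤ length V + c
ancestors-bound 𝒜 (c , access) n leaf s A eq 1≤s s≤n aft eqP with subst (s ∈_) (sym eq) (∈-keys 1≤s s≤n)
... | ()
ancestors-bound 𝒜 (c , access) n T@(node l k r) s A {V} {rest} eq 1≤s s≤n aft eqP =
  ℕ.≮⇒≥ λ lt → ℕ.<-irrefl refl (begin-strict
    M ^ suc (length V + c)        ≤⟨ ℕ.^-monoʳ-≤ M lt ⟩
    M ^ length (ancestors V A)    ≤⟨ main ⟩
    K * M ^ (length V + c)        <⟨ ℕ.m<n+m _ (ℕ.m^n>0 M (length V + c)) ⟩
    M ^ suc (length V + c)        ∎)
  where
  open ℕ.≤-Reasoning
  N = size T
  -- All that remains on the upper side besides powers of `M`: `N ^ N` from the potential of `T`,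
  -- and `(2 * N) ^ c` because the total weight is at most `N * M`. Since `M` exceeds `K`, one
  -- surplus power of `M` is already a contradiction.
  K = N ^ N * (2 * N) ^ c
  M = suc K
  1≤M : 1 ≤ M
  1≤M = s≤s z≤n
  w = heavy V M 1≤M
  P = searchPath T s
  T′ = rearrangeL P A T
  srt : Sorted (inorder T)
  srt = subst Sorted (sym eq) (sorted-keys n)
  accessℕ : 2 ^ length P * (expΦℕ w T′ * w s ^ c) ≤ expΦℕ w T * (2 * weightℕ w T) ^ c
  accessℕ = fromℕ-cancel-≤ (subst₂ ℚ._≤_ (sym lhs) (sym rhs)
    (access n T s A (fromℕ ∘ w) eq 1≤s s≤n (λ a _ _ → heavy-positive V K a) aft))
    where
    lhs : fromℕ (2 ^ length P * (expΦℕ w T′ * w s ^ c)) ≡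
          (two ^ℚ length P) ℚ.* (expΦ (fromℕ ∘ w) T′ ℚ.* (fromℕ (w s) ^ℚ c))
    lhs = trans (fromℕ-* (2 ^ length P) (expΦℕ w T′ * w s ^ c))
      (cong₂ ℚ._*_ (fromℕ-^ 2 (length P)) (trans (fromℕ-* (expΦℕ w T′) (w s ^ c))
        (cong₂ ℚ._*_ (fromℕ-expΦ w T′) (fromℕ-^ (w s) c))))
    rhs : fromℕ (expΦℕ w T * (2 * weightℕ w T) ^ c) ≡
          expΦ (fromℕ ∘ w) T ℚ.* ((two ℚ.* weight (fromℕ ∘ w) T) ^ℚ c)
    rhs = trans (fromℕ-* (expΦℕ w T) ((2 * weightℕ w T) ^ c))
      (cong₂ ℚ._*_ (fromℕ-expΦ w T) (trans (fromℕ-^ (2 * weightℕ w T) c)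
        (cong (_^ℚ c) (trans (fromℕ-* 2 (weightℕ w T)) (cong (two ℚ.*_) (fromℕ-weight w T))))))
  T′-≥ : M ^ length (ancestors V A) ≤ expΦℕ w T′
  T′-≥ = subst (λ t → M ^ length (ancestors V A) ≤ expΦℕ w t)
    (sym (rearrangeL-root A l r k∈P)) (expΦ-plug-≥ V M 1≤M A _)
    where
    k∈P : k ∈ P
    k∈P with searchPath-∷ l k r s
    ... | _ , e = subst (k ∈_) (sym e) (here refl)
  regroup : ∀ a b x y → a * b * (x * y) ≡ a * x * (b * y)
  regroup = solve-∀
  main : M ^ length (ancestors V A) ≤ K * M ^ (length V + c)
  main = begin
    M ^ length (ancestors V A)                  ≤⟨ T′-≥ ⟩
    expΦℕ w T′                                  ≡⟨ sym (trans (ℕ.*-identityˡ _) (ℕ.*-identityʳ _)) ⟩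
    -- The two ones stand for `2 ^ length P` and `w s ^ c`, whose only relevant property is to be at
    -- least 1.
    1 * (expΦℕ w T′ * 1)
      ≤⟨ ℕ.*-mono-≤ (ℕ.m^n>0 2 (length P)) (ℕ.*-monoʳ-≤ (expΦℕ w T′)
           (ℕ.≤-trans (ℕ.≤-reflexive (sym (ℕ.^-zeroˡ c))) (ℕ.^-monoˡ-≤ c (heavy-≥1 V M 1≤M s)))) ⟩
    2 ^ length P * (expΦℕ w T′ * w s ^ c)       ≤⟨ accessℕ ⟩
    expΦℕ w T * (2 * weightℕ w T) ^ c
      ≤⟨ ℕ.*-mono-≤ (ℕ.≤-trans (expΦ-≤ V M 1≤M T ℕ.≤-refl)
                      (ℕ.*-monoʳ-≤ (N ^ N) (ℕ.^-monoʳ-≤ M (path-ancestors V T s srt eqP λ _ x∈V → x∈V))))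
           (ℕ.^-monoˡ-≤ c (ℕ.≤-trans (ℕ.*-monoʳ-≤ 2 (weight-≤ V M 1≤M M T (λ {x} _ → heavy-≤M V M 1≤M x)))
                                     (ℕ.≤-reflexive (sym (ℕ.*-assoc 2 N M))))) ⟩
    N ^ N * M ^ length V * (2 * N * M) ^ c
      ≡⟨ cong (N ^ N * M ^ length V *_) (^-distribʳ-* (2 * N) M c) ⟩
    N ^ N * M ^ length V * ((2 * N) ^ c * M ^ c)
      ≡⟨ regroup (N ^ N) (M ^ length V) ((2 * N) ^ c) (M ^ c) ⟩
    K * (M ^ length V * M ^ c)                  ≡⟨ cong (K *_) (sym (ℕ.^-distribˡ-+-* M (length V) c)) ⟩
    K * M ^ (length V + c)                      ∎

-- Assembling the local decomposition

decomposition : ∀ {w s} ps σ → Valid s ps σ →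
  (∀ d → d ≤ length ps → length (windowAt s ps σ d) ≤ w) →
  LocalDecomposition w s (dirTree s ps) (erase (current s σ))
decomposition {w} {s} ps σ v len = record
  { k  = suc m
  ; Q  = λ i → treeAt s ps σ (suc m ∸ i)
  ; Ps = λ i → windowAt s ps σ (m ∸ i)
  ; Ts = λ i → afterAt s ps σ (m ∸ i)
  ; first = treeAt-last s ps σ v
  ; last  = trans (cong (treeAt s ps σ) (ℕ.n∸n≡0 m)) (treeAt-zero s ps σ)
  -- `suc m ∸ i` equals `suc (m ∸ i)` only for `i ≤ m`, hence the transports here and below.
  ; isPath = λ { i (s≤s i≤m) → subst (λ d → DownPath (treeAt s ps σ d) (windowAt s ps σ (m ∸ i)))
      (sym (ℕ.+-∸-assoc 1 i≤m)) (windowAt-path s ps σ (m ∸ i) v (ℕ.m∸n≤m m i)) }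
  ; isBST = λ i _ → AllPairs⇒Linked (afterAt-sorted s ps σ (m ∸ i) v (ℕ.m∸n≤m m i))
                  , afterAt-↭ s ps σ (m ∸ i) v (ℕ.m∸n≤m m i)
  ; step = λ { i (s≤s i≤m) →
      subst (λ d → treeAt s ps σ (m ∸ i) ≡
                   rearrangeL (windowAt s ps σ (m ∸ i)) (afterAt s ps σ (m ∸ i)) (treeAt s ps σ d))
        (sym (ℕ.+-∸-assoc 1 i≤m)) (windowAt-step s ps σ (m ∸ i) v (ℕ.m∸n≤m m i)) }
  ; start = s≤s z≤n , s∈windowAt s ps σ m
  ; progress = λ { i (s≤s i<m) →
      subst (λ d → ∃ λ x → x ∈ windowAt s ps σ (m ∸ suc i) × x ∉ windowAt s ps σ d)
        (sym (ℕ.+-∸-assoc 1 i<m))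
        (windowAt-progress s ps σ (m ∸ suc i) v (ℕ.∸-monoʳ-< (s≤s z≤n) i<m)) }
  ; overlaps = λ i _ → s , s∈windowAt s ps σ (m ∸ suc i) , s∈windowAt s ps σ (m ∸ i)
  ; noRevisit = λ { i j (s≤s i<j) (s≤s j≤m) x x∈i x∉ x∈j →
      x∉ (windowAt-persists s ps σ v (ℕ.∸-monoʳ-< i<j j≤m) x∈j
            (subst (λ d → x ∈ windowAt s ps σ d) (ℕ.+-∸-assoc 1 (ℕ.≤-trans (ℕ.<⇒≤ i<j) j≤m)) x∈i)) }
  ; window = λ i _ → len (m ∸ i) (ℕ.m∸n≤m m i)
  }
  where m = length ps

root-∷ : ∀ A {s} → root A ≡ s ∷ [] → ∃₂ λ l r → A ≡ node l s r
root-∷ (node l _ r) refl = l , r , refl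

theorem3 : (𝒜 : MinSelfAdjusting) → AccessLemmaSOL 𝒜 → IsLocal 𝒜
theorem3 𝒜 access@(c , _) = suc c , local
  where
  open MinSelfAdjusting 𝒜
  local : ∀ n T s A → IsBSTOnN n T → 1 ≤ s → s ≤ n → after n T s A →
          LocalDecomposition (suc c) s (pathTree T s) A
  local n T s A eq 1≤s s≤n aft
    with search-dirs T s (subst Sorted (sym eq) (sorted-keys n)) (subst (s ∈_) (sym eq) (∈-keys 1≤s s≤n))
       | root-∷ A (afterRoot aft)
  ... | ps , eqP , eqT , sub | l , r , refl =
    subst (λ P → LocalDecomposition (suc c) s P (node l s r)) (sym eqT)
      (decomposition ps σ v λ d _ →
        windowAt-length s (node l s r) [] ps σ d v from bound unique
          (∈-resp-↭ (↭-sym A↭)) root-ancestor)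
    where
    -- Since `s` is its root, `A` itself is a state: its two subtrees are the outermost gaps, and
    -- only `s` is marked.
    σ : State
    σ = state (upd true l (λ _ → r)) (λ _ → [])
    srt : Sorted (inorder (dirTree s ps))
    srt = AllPairs-resp-⊆ sub (subst Sorted (sym eq) (sorted-keys n))
    A↭ : inorder (node l s r) ↭ pathKeys s ps
    A↭ = ↭-trans (proj₂ (afterBST aft)) (↭-reflexive eqP)
    v : Valid s ps σ
    v = valid (sorted-↭⇒≡ (Linked⇒AllPairs ℕ.<-trans (proj₁ (afterBST aft))) srt
                (↭-trans A↭ (↭-sym (dirTree-↭ s ps)))) srt
    unique : Unique (pathKeys s ps)
    unique = pathKeys-unique s v
    from : From (node l s r) [] σ
    from true  = inL here , []
    from false = inR here , []
    bound : ∀ V rest → map proj₂ ps ≡ V ++ rest → length (ancestors V (node l s r)) ≤ length V + c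
    bound V rest e = ancestors-bound 𝒜 access n T s (node l s r) eq 1≤s s≤n aft
      (trans eqP (trans (cong (_++ [ s ]) e) (++-assoc V rest [ s ])))
    root-ancestor : ∀ {V x} → x ∈ V → x ∈ inorder (node l s r) → IsAncestor V (node l s r) s
    root-ancestor x∈V x∈A = l , r , here , Any.map (λ { refl → x∈V }) x∈A
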